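{- Let $G$ be a planar graph of girth at least $7$ and let $\pi:E(G)\to\mathbb{F}_2$. Then there exists a strict $3$-inversion of $(G,\pi)$.
   Context: Graphs are finite and simple; the girth of a graph is the length of a shortest cycle (infinite for forests). For a positive integer $t$, a $t$-inversion of $(G,\pi)$ is an assignment of a vector $\mathbf{u}\in\mathbb{F}_2^t$ to each vertex $u\in V(G)$ such that $\pi(uv)=\mathbf{u}\cdot\mathbf{v}$ (standard dot product over $\mathbb{F}_2$) for every edge $uv\in E(G)$. A $t$-inversion is strict if every vertex is assigned a non-null vector. -}

module Defs where

open import Data.Bool using (Bool; false; T)
open import Data.Fin using (Fin; zero; suc; inject₁; fromℕ)
open import Data.Nat using (ℕ; suc; _+_; _*_; _≤_)
open import Data.Nat.GeneralisedArithmetic using (fold)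
open import Data.Parity using (Parity; 0ℙ)
import Data.Parity as ℙ
open import Data.Product using (Σ; ∃-syntax; _×_)
open import Data.Vec using (Vec; foldr′; zipWith; replicate)
open import Function using (_∘_; _↔_; _↠_; _⇔_; Inverse; Surjection; Injective)
open import Relation.Binary.Construct.Add.Supremum.NonStrict _≤_ using (_≤⁺_)
open import Relation.Binary.Construct.Closure.ReflexiveTransitive using (Star)
open import Relation.Binary.PropositionalEquality using (_≡_; _≢_; subst)
open import Relation.Nullary using (¬_)
open import Relation.Nullary.Construct.Add.Supremum using (_⁺; [_]; ⊤⁺)

record Graph (n : ℕ) : Set where
  field
    adjacent    : Fin n → Fin n → Bool
    symmetric   : ∀ u v → adjacent u v ≡ adjacent v u
    irreflexive : ∀ v → adjacent v v ≡ false

  Adj : Fin n → Fin n → Set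
  Adj u v = T (adjacent u v)

  Adj-sym : ∀ {u v} → Adj u v → Adj v u
  Adj-sym {u} {v} = subst T (symmetric u v)

open Graph public using (Adj; Adj-sym)

-- An orientation of an edge. Since T is proof-irrelevant, a dart is
-- determined by its two ends; every edge carries exactly two darts.
record Dart {n} (G : Graph n) : Set where
  constructor dart
  field
    source : Fin n
    target : Fin n
    edge   : Adj G source target

open Dart public

reverse : ∀ {n} (G : Graph n) → Dart G → Dart G
reverse G (dart u v e) = dart v u (Adj-sym G e)

-- Cycle G m is a cycle of length suc m, so that the condition on m says
-- that cycles have length at least 3.
record Cycle {n} (G : Graph n) (m : ℕ) : Set where
  field
    long      : 2 ≤ m
    vertex    : Fin (suc m) → Fin n
    injective : Injective _≡_ _≡_ vertex
    step      : ∀ i → Adj G (vertex (inject₁ i)) (vertex (suc i))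
    close     : Adj G (vertex (fromℕ m)) (vertex zero)

data IsGirth {n} (G : Graph n) : ℕ ⁺ → Set where
  shortest : ∀ {m} → Cycle G m → (∀ {k} → Cycle G k → suc m ≤ suc k) →
             IsGirth G [ suc m ]
  forest   : (∀ {k} → ¬ Cycle G k) → IsGirth G ⊤⁺

GirthAtLeast : ∀ {n} → ℕ → Graph n → Set
GirthAtLeast g G = ∃[ γ ] IsGirth G γ × [ g ] ≤⁺ γ

SameOrbit : {A : Set} → (A → A) → A → A → Set
SameOrbit f x y = ∃[ k ] fold x f k ≡ y

-- R is an equivalence relation with exactly k classes: it is the kernel of
-- a surjection onto Fin k.
HasClasses : {A : Set} → (A → A → Set) → ℕ → Set
HasClasses {A} R k =
  Σ (A ↠ Fin k) λ class →
    ∀ x y → R x y ⇔ (Surjection.to class x ≡ Surjection.to class y)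

-- A rotation system: a cyclic ordering, at each vertex, of the darts leaving
-- it. It encodes an embedding of each component of G in an oriented surface.
record RotationSystem {n} (G : Graph n) : Set where
  field
    rotation : Dart G ↔ Dart G

  next : Dart G → Dart G
  next = Inverse.to rotation

  field
    next-source : ∀ d → source (next d) ≡ source d
    cyclic      : ∀ d d′ → source d ≡ source d′ → SameOrbit next d d′

  faceStep : Dart G → Dart G
  faceStep = next ∘ reverse G

SameComponent : ∀ {n} (G : Graph n) → Dart G → Dart G → Set
SameComponent G d d′ = Star (Adj G) (source d) (source d′)

-- Planarity by combinatorial maps: G has a rotation system of genus 0.
-- All four quantities count classes of darts, so isolated vertices, which are
-- irrelevant to planarity, enter neither #vertices nor #components. Each
-- component is placed on its own sphere, hence Euler's formula reads
-- V - E + F = 2 C. A component of genus g contributes 2 - 2g to the left-hand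
-- side, so equality forces every component to have genus 0.
record Planar {n} (G : Graph n) : Set where
  field
    rotationSystem : RotationSystem G

  open RotationSystem rotationSystem

  field
    #vertices #edges #faces #components : ℕ
    countVertices   : HasClasses (SameOrbit next) #vertices
    countEdges      : HasClasses (SameOrbit (reverse G)) #edges
    countFaces      : HasClasses (SameOrbit faceStep) #faces
    countComponents : HasClasses (SameComponent G) #components
    euler           : #vertices + #faces ≡ #edges + 2 * #components

-- The field with two elements is the library's Parity.
𝔽₂ : Set
𝔽₂ = Parity

-- A function E(G) → 𝔽₂, given on darts and independent of the orientation.
record EdgeLabelling {n} (G : Graph n) : Set where
  field
    label         : Dart G → 𝔽₂
    label-reverse : ∀ d → label (reverse G d) ≡ label d

_·_ : ∀ {t} → Vec 𝔽₂ t → Vec 𝔽₂ t → 𝔽₂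
u · v = foldr′ ℙ._+_ 0ℙ (zipWith ℙ._*_ u v)

IsInversion : ∀ {n} (G : Graph n) (π : EdgeLabelling G) (t : ℕ) →
              (Fin n → Vec 𝔽₂ t) → Set
IsInversion G π t vec =
  ∀ d → EdgeLabelling.label π d ≡ vec (source d) · vec (target d)

IsStrict : ∀ {n t} → (Fin n → Vec 𝔽₂ t) → Set
IsStrict {t = t} vec = ∀ v → vec v ≢ replicate t 0ℙ

{-# OPTIONS --safe #-}
module Submission where

-- Colour the vertices with the seven non-null vectors, and consider a subgraph H
-- with a minimal number of edges that has no proper colouring. If the other
-- neighbours of a vertex u rule out at most 5 (at most 4) of its colours, then u,
-- when recolourable, rules out only 2 (only 1) colours of a neighbour x, instead
-- of the 4 ruled out by a fixed u. Iterating this three times along the edges at a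
-- vertex r, the sum of these costs over the neighbours of r is at least 7:
-- otherwise some colour of r would be free. The trees of recoloured vertices do
-- not interfere, as H has no cycle of length at most 6 and no two adjacent
-- vertices of degree 2. By discharging, these inequalities alone force 10 deg u ≥
-- 28 on average. On the other hand Euler's formula for H, whose faces have length
-- at least 7, gives 10 deg u < 28 on average. That H inherits genus 0 from G is
-- seen by detaching the superfluous darts one at a time: this composes the vertex
-- and the face permutation with a transposition.

open import Defs
open import Data.Bool using (Bool; true; false; T; if_then_else_)
open import Data.Bool.Properties using (T?; T-irrelevant)
open import Data.Empty using (⊥; ⊥-elim)
open import Data.Fin using (Fin; zero; suc; toℕ; fromℕ<; combine; remQuot)
open import Data.Fin.Permutation using (Permutation′; _⟨$⟩ʳ_; _⟨$⟩ˡ_; inverseˡ; permutation; transpose; _∘ₚ_)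
open import Data.Fin.Properties using (_≟_; any?; all?; toℕ<n; toℕ-injective; toℕ-inject₁; toℕ-fromℕ; toℕ-fromℕ<; combine-remQuot; remQuot-combine)
open import Data.Nat using (ℕ; zero; suc; _+_; _*_; _∸_; _≤_; _<_; z≤n; s≤s; _≤?_)
open import Data.Nat.GeneralisedArithmetic using (fold)
open import Data.Nat.Induction using (<-rec)
open import Data.Nat.Properties as ℕₚ using (≤-refl; ≤-trans; ≤-reflexive; +-mono-≤; m≤m+n)
open import Data.Nat.Tactic.RingSolver using (solve-∀)
open import Data.Parity using (0ℙ; 1ℙ)
import Data.Parity.Properties as ℙₚ
open import Data.Product using (Σ; ∃; ∃₂; _×_; _,_; proj₁; proj₂)
open import Data.Sum using (_⊎_; inj₁; inj₂)
open import Data.Unit using (⊤; tt)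
open import Data.Vec using (Vec; []; _∷_; lookup; replicate; tabulate)
open import Data.Vec.Properties using (≡-dec; lookup∘tabulate)
open import Function using (_∘_; id; _↔_; mk↔ₛ′; Inverse; Surjection; Equivalence)
open import Function.Properties.Inverse using (↔-sym; ↔-trans)
open import Level using (0ℓ)
open import Relation.Binary.Construct.Add.Supremum.NonStrict _≤_ using () renaming ([_] to [_]≤)
open import Relation.Binary.Construct.Closure.ReflexiveTransitive using (Star; ε; _◅_)
import Relation.Binary.Construct.On as On
open import Relation.Binary.Core using (Rel; _⇒_)
open import Relation.Binary.Definitions using (tri<; tri≈; tri>)
open import Relation.Binary.PropositionalEquality using (_≡_; _≢_; refl; sym; trans; cong; cong₂; subst; subst₂; isEquivalence; module ≡-Reasoning)
open import Relation.Binary.Structures using (IsEquivalence)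
open import Relation.Nullary using (¬_; Dec; yes; no; does; contradiction; ¬?; _×-dec_; _⊎-dec_; _→-dec_)
open import Relation.Nullary.Decidable using (decidable-stable; dec-true; dec-false; does-≡; map′; toWitness)
open import Algebra.Properties.CommutativeSemigroup ℕₚ.+-commutativeSemigroup using (x∙yz≈y∙xz; x∙yz≈z∙xy)
open import Algebra.Properties.Semiring.Sum ℕₚ.+-*-semiring
  using (sum; sum-cong-≗; ∑-distrib-+; ∑-comm; sum-permute; *-distribˡ-sum; sum-replicate-zero)

-- The counts 4, 2, 1 are linear algebra: a colour of `x` fails against `u` only if it has the wrong
-- product with every available colour of `u`, and up to three distinct available vectors each about
-- halve what is left. Costs depend on the graph alone, not on the colouring, so the inequalities at
-- all vertices can enter one discharging. Depth three is what the discharging consumes: a vertex of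
-- degree 2 is cheap at depth 1, a vertex of degree 3 next to it at depth 2, suitable vertices of
-- degree 3 next to those at depth 3. But an edge between two branches of depth three closes a cycle
-- of length exactly 7, which the girth allows; hence depth 1 is exploited beforehand to show that
-- vertices of degree 2 are never adjacent. The bound 28/10 is 2·7/(7 - 2), the limit of the average
-- degree at girth 7. An edge deleted from the map is not erased: its two darts become fixed points
-- of the vertex permutation, a sphere of its own with two vertices, one edge and one face, which
-- satisfies Euler's formula by itself. So the set of darts and the edge involution never change.

-- Finite sums, counting and linear arithmetic

when : {P : Set} → Dec P → ℕ → ℕ
when d x = if does d then x else 0

count : ∀ {n} {P : Fin n → Set} → (∀ i → Dec (P i)) → ℕ
count P? = sum λ i → when (P? i) 1

when-yes : {P : Set} (d : Dec P) {x : ℕ} → P → when d x ≡ x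
when-yes d p rewrite dec-true d p = refl

when-no : {P : Set} (d : Dec P) {x : ℕ} → ¬ P → when d x ≡ 0
when-no d ¬p rewrite dec-false d ¬p = refl

when-≤ : {P : Set} (d : Dec P) {x y : ℕ} → (P → x ≤ y) → when d x ≤ y
when-≤ (yes p) h = h p
when-≤ (no _)  h = z≤n

when-cong : {P : Set} (d : Dec P) {x y : ℕ} → (P → x ≡ y) → when d x ≡ when d y
when-cong (yes p) h = h p
when-cong (no _)  h = refl

when-mono : {P Q : Set} (d : Dec P) (e : Dec Q) {x y : ℕ} →
            (P → Q) → (P → x ≤ y) → when d x ≤ when e y
when-mono d e h k = when-≤ d λ p → subst (_ ≤_) (sym (when-yes e (h p))) (k p)

when-positive : {P : Set} (d : Dec P) {x : ℕ} → 1 ≤ when d x → P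
when-positive (yes p) _ = p

when-swap : {P Q : Set} (d : Dec P) (e : Dec Q) (x : ℕ) → when d (when e x) ≡ when e (when d x)
when-swap (yes _) e       x = refl
when-swap (no _)  (yes _) x = refl
when-swap (no _)  (no _)  x = refl

when-+ : {P : Set} (d : Dec P) (x y : ℕ) → when d (x + y) ≡ when d x + when d y
when-+ (yes _) x y = refl
when-+ (no _)  x y = refl

when-* : {P : Set} (d : Dec P) (k x : ℕ) → k * when d x ≡ when d (k * x)
when-* (yes _) k x = refl
when-* (no _)  k x = ℕₚ.*-zeroʳ k

sum-mono : ∀ {n} {f g : Fin n → ℕ} → (∀ i → f i ≤ g i) → sum f ≤ sum g
sum-mono {zero}  h = z≤n
sum-mono {suc n} h = +-mono-≤ (h zero) (sum-mono (h ∘ suc))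

sum-zero : ∀ {n} {f : Fin n → ℕ} → (∀ i → f i ≡ 0) → sum f ≡ 0
sum-zero {n} h = trans (sum-cong-≗ h) (sum-replicate-zero n)

sum-const : ∀ n c → sum {n} (λ _ → c) ≡ n * c
sum-const zero    c = refl
sum-const (suc n) c = cong (c +_) (sum-const n c)

off : ∀ {n} → Fin n → (Fin n → ℕ) → Fin n → ℕ
off a f i = when (¬? (i ≟ a)) (f i)

sum-off : ∀ {n} (a : Fin n) (f : Fin n → ℕ) → sum f ≡ f a + sum (off a f)
sum-off zero f = cong (f zero +_) (sum-cong-≗ {_} {λ i → f (suc i)} {λ i → off zero f (suc i)} λ i → refl)
sum-off {suc n} (suc a) f = begin
  f zero + sum (f ∘ suc)                        ≡⟨ cong (f zero +_) (sum-off a (f ∘ suc)) ⟩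
  f zero + (f (suc a) + sum (off a (f ∘ suc)))  ≡⟨ x∙yz≈y∙xz (f zero) (f (suc a)) _ ⟩
  f (suc a) + (f zero + sum (off a (f ∘ suc)))  ≡⟨ cong (λ z → f (suc a) + (f zero + z)) (sum-cong-≗ shift) ⟩
  f (suc a) + (f zero + sum (λ i → off (suc a) f (suc i))) ∎
  where
  open ≡-Reasoning
  shift : ∀ i → off a (f ∘ suc) i ≡ off (suc a) f (suc i)
  shift i with i ≟ a
  ... | yes _ = refl
  ... | no _  = refl

sum-≥ : ∀ {n} (f : Fin n → ℕ) (a : Fin n) → f a ≤ sum f
sum-≥ f a = subst (f a ≤_) (sym (sum-off a f)) (m≤m+n _ _)

sum-single : ∀ {n} (f : Fin n → ℕ) (a : Fin n) → (∀ i → i ≢ a → f i ≡ 0) → sum f ≡ f a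
sum-single f a h = trans (sum-off a f) (trans (cong (f a +_) (sum-zero zeros)) (ℕₚ.+-identityʳ _))
  where
  zeros : ∀ i → off a f i ≡ 0
  zeros i with i ≟ a
  ... | yes _ = refl
  ... | no ne = h i ne

sum-atMostOne : ∀ {n} (f : Fin n → ℕ) → (∀ i → f i ≤ 1) →
                (∀ i j → 1 ≤ f i → 1 ≤ f j → i ≡ j) → sum f ≤ 1
sum-atMostOne f f≤1 uniq with any? (λ i → 1 ≤? f i)
... | yes (a , 1≤fa) = subst (_≤ 1) (sym (sum-single f a zeros)) (f≤1 a)
  where
  zeros : ∀ i → i ≢ a → f i ≡ 0
  zeros i ne = ℕₚ.n<1⇒n≡0 (ℕₚ.≰⇒> λ 1≤fi → ne (uniq i a 1≤fi 1≤fa))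
... | no none = ≤-trans (≤-reflexive (sum-zero λ i → ℕₚ.n<1⇒n≡0 (ℕₚ.≰⇒> λ 1≤fi → none (i , 1≤fi)))) z≤n

sum-witness : ∀ {n} (f : Fin n → ℕ) → 1 ≤ sum f → ∃ λ i → 1 ≤ f i
sum-witness f h with any? (λ i → 1 ≤? f i)
... | yes w   = w
... | no none = contradiction (subst (1 ≤_) (sum-zero λ i → ℕₚ.n<1⇒n≡0 (ℕₚ.≰⇒> λ p → none (i , p))) h) λ ()

count-witness : ∀ {n} {P : Fin n → Set} (P? : ∀ i → Dec (P i)) → 1 ≤ count P? → ∃ P
count-witness P? h = let i , q = sum-witness _ h in i , when-positive (P? i) q

count-mono : ∀ {n} {P Q : Fin n → Set} (P? : ∀ i → Dec (P i)) (Q? : ∀ i → Dec (Q i)) →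
             (∀ i → P i → Q i) → count P? ≤ count Q?
count-mono P? Q? h = sum-mono λ i → when-mono (P? i) (Q? i) (h i) λ _ → ≤-refl

count-remove : ∀ {n} {P : Fin n → Set} (P? : ∀ i → Dec (P i)) {k} → suc k ≤ count P? →
               ∃ λ a → P a × k ≤ count (λ i → P? i ×-dec ¬? (i ≟ a))
count-remove {P = P} P? {k} h with count-witness P? (≤-trans (s≤s z≤n) h)
... | a , Pa = a , Pa , ℕₚ.+-cancelˡ-≤ 1 _ _ (≤-trans h (≤-reflexive eq))
  where
  offEq : ∀ i → off a (λ i → when (P? i) 1) i ≡ when (P? i ×-dec ¬? (i ≟ a)) 1
  offEq i with P? i | i ≟ a
  ... | yes _ | yes _ = refl
  ... | yes _ | no _  = refl
  ... | no _  | yes _ = refl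
  ... | no _  | no _  = refl
  eq : count P? ≡ suc (count (λ i → P? i ×-dec ¬? (i ≟ a)))
  eq = trans (sum-off a _) (cong₂ _+_ (when-yes (P? a) Pa) (sum-cong-≗ offEq))

-- A certificate for linear inequalities: `A` and `B` are the left and right sides of known
-- inequalities, added up with multipliers, and `s` is the slack. What remains to be checked is a
-- polynomial identity.
farkas : ∀ {A B} X Y s → A ≤ B → X + B + s ≡ Y + A → X ≤ Y
farkas {A} {B} X Y s A≤B eq = ℕₚ.+-cancelʳ-≤ B X Y (begin
  X + B      ≤⟨ m≤m+n (X + B) s ⟩
  X + B + s  ≡⟨ eq ⟩
  Y + A      ≤⟨ ℕₚ.+-monoʳ-≤ Y A≤B ⟩
  Y + B      ∎)
  where open ℕₚ.≤-Reasoning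

-- Colours and the colours they rule out

Colour : Set
Colour = Fin 7

vectors : Vec (Vec 𝔽₂ 3) 7
vectors = (0ℙ ∷ 0ℙ ∷ 1ℙ ∷ []) ∷ (0ℙ ∷ 1ℙ ∷ 0ℙ ∷ []) ∷ (0ℙ ∷ 1ℙ ∷ 1ℙ ∷ [])
        ∷ (1ℙ ∷ 0ℙ ∷ 0ℙ ∷ []) ∷ (1ℙ ∷ 0ℙ ∷ 1ℙ ∷ []) ∷ (1ℙ ∷ 1ℙ ∷ 0ℙ ∷ []) ∷ (1ℙ ∷ 1ℙ ∷ 1ℙ ∷ []) ∷ []

vectorOf : Colour → Vec 𝔽₂ 3
vectorOf = lookup vectors

vectorOf≢0 : ∀ q → vectorOf q ≢ replicate 3 0ℙ
vectorOf≢0 = toWitness {a? = all? λ q → ¬? (≡-dec ℙₚ._≟_ (vectorOf q) (replicate 3 0ℙ))} _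

dot : Colour → Colour → 𝔽₂
dot p q = vectorOf p · vectorOf q

dot-comm : ∀ p q → dot p q ≡ dot q p
dot-comm = toWitness {a? = all? λ p → all? λ q → dot p q ℙₚ.≟ dot q p} _

Misses : 𝔽₂ → Colour → Colour → Set
Misses b q p = dot q p ≢ b

misses? : ∀ b q p → Dec (Misses b q p)
misses? b q p = ¬? (dot q p ℙₚ.≟ b)

allParity? : {P : 𝔽₂ → Set} → (∀ b → Dec (P b)) → Dec (∀ b → P b)
allParity? P? with P? 0ℙ | P? 1ℙ
... | yes p | yes q = yes λ { 0ℙ → p ; 1ℙ → q }
... | no ¬p | _     = no λ h → ¬p (h 0ℙ)
... | _     | no ¬q = no λ h → ¬q (h 1ℙ)

-- The wrong products form an affine plane of 4 vectors; for `b = 1` it contains the null vector,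
-- which is no colour.
misses-one : ∀ b p → count (λ q → misses? b q p) ≤ 4
misses-one = toWitness {a? = allParity? λ b → all? λ p → count (λ q → misses? b q p) ≤? 4} _

-- Distinct non-null vectors over the two-element field are independent, so the two conditions leave
-- an affine line.
misses-two : ∀ b p p′ → p′ ≢ p →
             count (λ q → misses? b q p ×-dec misses? b q p′) ≤ 2
misses-two = toWitness {a? = allParity? λ b → all? λ p → all? λ p′ → ¬? (p′ ≟ p) →-dec
  (count (λ q → misses? b q p ×-dec misses? b q p′) ≤? 2)} _

-- An independent third vector leaves one point. If `p″` is the sum of the other two, the conditions
-- are contradictory for `b = 0`, and for `b = 1` they leave a line through the null vector, hence
-- one colour.
misses-three : ∀ b p p′ p″ → p′ ≢ p → p″ ≢ p → p″ ≢ p′ →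
               count (λ q → misses? b q p ×-dec misses? b q p′ ×-dec misses? b q p″) ≤ 1
misses-three = toWitness {a? = allParity? λ b → all? λ p → all? λ p′ → all? λ p″ →
  ¬? (p′ ≟ p) →-dec ¬? (p″ ≟ p) →-dec ¬? (p″ ≟ p′) →-dec
  (count (λ q → misses? b q p ×-dec misses? b q p′ ×-dec misses? b q p″) ≤? 1)} _

module _ {A : Colour → Set} (A? : ∀ p → Dec (A p)) (b : 𝔽₂) where

  MissesAll : Colour → Set
  MissesAll q = ∀ p → A p → Misses b q p

  missesAll? : ∀ q → Dec (MissesAll q)
  missesAll? q = all? λ p → A? p →-dec misses? b q p

  private
    except : ∀ p i → Dec (A i × i ≢ p)
    except p i = A? i ×-dec ¬? (i ≟ p)

  missesAll-≤2 : 2 ≤ count A? → count missesAll? ≤ 2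
  missesAll-≤2 h with count-remove A? h
  ... | p , Ap , h₁ with count-witness (except p) h₁
  ... | p′ , Ap′ , p′≢p = ≤-trans
    (count-mono missesAll? (λ q → misses? b q p ×-dec misses? b q p′) λ q m → m p Ap , m p′ Ap′) (misses-two b p p′ p′≢p)

  missesAll-≤1 : 3 ≤ count A? → count missesAll? ≤ 1
  missesAll-≤1 h with count-remove A? h
  ... | p , Ap , h₁ with count-remove (except p) h₁
  ... | p′ , (Ap′ , p′≢p) , h₂ with count-witness (λ i → except p i ×-dec ¬? (i ≟ p′)) h₂
  ... | p″ , (Ap″ , p″≢p) , p″≢p′ = ≤-trans
    (count-mono missesAll? (λ q → misses? b q p ×-dec misses? b q p′ ×-dec misses? b q p″) λ q m → m p Ap , m p′ Ap′ , m p″ Ap″)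
    (misses-three b p p′ p″ p′≢p p″≢p p″≢p′)

-- Walks without backtracking, and trees of recolourable vertices

adj? : ∀ {n} (H : Graph n) u v → Dec (Adj H u v)
adj? H u v = T? (Graph.adjacent H u v)

adj-irrefl : ∀ {n} (H : Graph n) {v} → ¬ Adj H v v
adj-irrefl H {v} = subst T (Graph.irreflexive H v)

degree : ∀ {n} → Graph n → Fin n → ℕ
degree H u = count (adj? H u)

Positive : ∀ {n} → Graph n → Fin n → Set
Positive H u = 1 ≤ degree H u

positive? : ∀ {n} (H : Graph n) u → Dec (Positive H u)
positive? H u = 1 ≤? degree H u

neighbourSum : ∀ {n} → Graph n → Fin n → (Fin n → ℕ) → ℕ
neighbourSum H u f = sum λ w → when (adj? H u w) (f w)

LongCycles : ∀ {n} → Graph n → Set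
LongCycles H = ∀ {k} → Cycle H k → 7 ≤ suc k

-- Path H a b e ℓ: a walk without backtracking of length ℓ from a to e whose
-- second vertex is b.
data Path {n : ℕ} (H : Graph n) : (a b e : Fin n) → ℕ → Set where
  link : ∀ {a b} → Adj H a b → Path H a b b 1
  cons : ∀ {a b c e ℓ} → Adj H a b → a ≢ c → Path H b c e ℓ → Path H a b e (suc ℓ)

module _ {n : ℕ} (H : Graph n) where

  -- Strong induction on the length: a repetition inside the walk closes a shorter one of the same
  -- kind, so the vertices before the return are distinct and form a cycle of length at most 6.
  -- Walks are functions on the naturals so that a segment is a mere shift; backtracking is excluded
  -- at inner vertices, the form that segments inherit.
  closed-function : LongCycles H → ∀ ℓ (W : ℕ → Fin n) → 1 ≤ ℓ → ℓ ≤ 6 →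
    (∀ i → i < ℓ → Adj H (W i) (W (suc i))) →
    (∀ i → suc i < ℓ → W i ≢ W (2 + i)) → W 0 ≢ W ℓ
  closed-function long = <-rec _ rec
    where
    rec : ∀ ℓ → (∀ {ℓ′} → ℓ′ < ℓ → (W : ℕ → Fin n) → 1 ≤ ℓ′ → ℓ′ ≤ 6 →
            (∀ i → i < ℓ′ → Adj H (W i) (W (suc i))) →
            (∀ i → suc i < ℓ′ → W i ≢ W (2 + i)) → W 0 ≢ W ℓ′) →
          (W : ℕ → Fin n) → 1 ≤ ℓ → ℓ ≤ 6 →
          (∀ i → i < ℓ → Adj H (W i) (W (suc i))) →
          (∀ i → suc i < ℓ → W i ≢ W (2 + i)) → W 0 ≢ W ℓ
    rec 1 _ W _ _ adj _ eq = adj-irrefl H (subst (Adj H (W 0)) (sym eq) (adj 0 ≤-refl))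
    rec 2 _ W _ _ _ nb eq = nb 0 ≤-refl eq
    rec ℓ@(suc m@(suc (suc _))) ih W _ ℓ≤6 adj nb eq =
      ℕₚ.<⇒≱ (s≤s ℓ≤6) (long (record
        { long = s≤s (s≤s z≤n)
        ; vertex = W ∘ toℕ
        ; injective = inj
        ; step = λ i → subst (λ z → Adj H (W z) (W (suc (toℕ i)))) (sym (toℕ-inject₁ i))
                   (adj (toℕ i) (ℕₚ.m<n⇒m<1+n (toℕ<n i)))
        ; close = subst₂ (Adj H) (cong W (sym (toℕ-fromℕ m))) (sym eq) (adj m ≤-refl)
        }))
      where
      distinct : ∀ i j → i < j → j < ℓ → W i ≢ W j
      distinct i j i<j j<ℓ eqᵢⱼ = ih {j ∸ i} (ℕₚ.≤-<-trans (ℕₚ.m∸n≤m j i) j<ℓ) (λ k → W (k + i))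
        (ℕₚ.m<n⇒0<n∸m i<j) (≤-trans (ℕₚ.m∸n≤m j i) (≤-trans (ℕₚ.<⇒≤ j<ℓ) ℓ≤6))
        (λ k k< → adj (k + i) (ℕₚ.<-trans (bound k k<) j<ℓ))
        (λ k k< → nb (k + i) (ℕₚ.<-trans (bound (suc k) k<) j<ℓ))
        (trans eqᵢⱼ (cong W (sym (ℕₚ.m∸n+n≡m (ℕₚ.<⇒≤ i<j)))))
        where
        bound : ∀ k → k < j ∸ i → k + i < j
        bound k k< = subst (k + i <_) (ℕₚ.m∸n+n≡m (ℕₚ.<⇒≤ i<j)) (ℕₚ.+-monoˡ-< i k<)
      inj : ∀ {i j : Fin ℓ} → W (toℕ i) ≡ W (toℕ j) → i ≡ j
      inj {i} {j} e with ℕₚ.<-cmp (toℕ i) (toℕ j)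
      ... | tri< l _ _ = contradiction e (distinct _ _ l (toℕ<n j))
      ... | tri≈ _ q _ = toℕ-injective q
      ... | tri> _ _ l = contradiction (sym e) (distinct _ _ l (toℕ<n i))

  private
    at : ∀ {a b e ℓ} → Path H a b e ℓ → ℕ → Fin n
    at {a} p              zero    = a
    at {b = b} (link _)   (suc i) = b
    at (cons _ _ p)       (suc i) = at p i

    at₁ : ∀ {a b e ℓ} (p : Path H a b e ℓ) → at p 1 ≡ b
    at₁ (link _) = refl
    at₁ (cons _ _ p) = refl

    at-end : ∀ {a b e ℓ} (p : Path H a b e ℓ) → at p ℓ ≡ e
    at-end (link _) = refl
    at-end (cons _ _ p) = at-end p

    at-adj : ∀ {a b e ℓ} (p : Path H a b e ℓ) i → i < ℓ → Adj H (at p i) (at p (suc i))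
    at-adj (link a) zero _ = a
    at-adj (link a) (suc i) (s≤s ())
    at-adj (cons a _ p) zero _ = a
    at-adj (cons a _ p) (suc i) (s≤s l) = at-adj p i l

    at-nb : ∀ {a b e ℓ} (p : Path H a b e ℓ) i → suc i < ℓ → at p i ≢ at p (2 + i)
    at-nb (link _) i (s≤s ())
    at-nb (cons _ a≢c p) zero _ eq = a≢c (trans eq (at₁ p))
    at-nb (cons _ _ p) (suc i) (s≤s l) = at-nb p i l

  path-positive : ∀ {a b e ℓ} → Path H a b e ℓ → 1 ≤ ℓ
  path-positive (link _) = s≤s z≤n
  path-positive (cons _ _ _) = s≤s z≤n

  path-open : LongCycles H → ∀ {a b e ℓ} → Path H a b e ℓ → ℓ ≤ 6 → a ≢ e
  path-open long {ℓ = ℓ} p ℓ≤6 a≡e = closed-function long ℓ (at p) (path-positive p) ℓ≤6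
    (at-adj p) (at-nb p) (trans a≡e (sym (at-end p)))

  -- With the edge `ae` put in front, the path returns to `e` in at most 6 steps without
  -- backtracking, unless `e` is its second vertex; then the rest of the path is already closed.
  path-nonadjacent : LongCycles H → ∀ {a b e ℓ} → Path H a b e ℓ → 2 ≤ ℓ → ℓ ≤ 5 → ¬ Adj H a e
  path-nonadjacent long (link _) (s≤s ()) _ _
  path-nonadjacent long {a} {b} {e} p@(cons _ _ q) _ ℓ≤5 ae with e ≟ b
  ... | yes refl = path-open long q (ℕₚ.m≤n⇒m≤1+n (ℕₚ.<⇒≤ ℓ≤5)) refl
  ... | no e≢b = path-open long (cons (Adj-sym H ae) e≢b p) (s≤s ℓ≤5) refl

-- Of seven colours, a demand of at most 4 leaves three and a demand of at most 5 leaves two. A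
-- single remaining colour gains nothing over keeping the old one, so from 6 on the vertex is not
-- recoloured.
price : ℕ → ℕ
price t with t ≤? 4 | t ≤? 5
... | yes _ | _     = 1
... | no _  | yes _ = 2
... | no _  | no _  = 4

price-≤4 : ∀ t → price t ≤ 4
price-≤4 t with t ≤? 4 | t ≤? 5
... | yes _ | _     = s≤s z≤n
... | no _  | yes _ = s≤s (s≤s z≤n)
... | no _  | no _  = ≤-refl

price-1 : ∀ {t} → t ≤ 4 → price t ≡ 1
price-1 {t} h with t ≤? 4
... | yes _ = refl
... | no ¬h = contradiction h ¬h

price-≤2 : ∀ {t} → t ≤ 5 → price t ≤ 2
price-≤2 {t} h with t ≤? 4 | t ≤? 5
... | yes _ | _     = s≤s z≤n
... | no _  | yes _ = ≤-refl
... | no _  | no ¬h = contradiction h ¬h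

price-cases : ∀ t → (t ≤ 4 × price t ≡ 1) ⊎ (t ≤ 5 × price t ≡ 2) ⊎ price t ≡ 4
price-cases t with t ≤? 4 | t ≤? 5
... | yes h | _     = inj₁ (h , refl)
... | no _  | yes h = inj₂ (inj₁ (h , refl))
... | no _  | no _  = inj₂ (inj₂ refl)

-- cost k x u bounds the number of colours of x that are ruled out by its
-- neighbour u, when u may be recoloured together with a tree of depth k hanging
-- from the edge xu. Such a u has at least 7 − t available colours, where t is the
-- total cost of its other neighbours; keeping the colour of u costs 4.
cost : ∀ {n} → Graph n → ℕ → Fin n → Fin n → ℕ
demand : ∀ {n} → Graph n → ℕ → Fin n → {P : Fin n → Set} → (∀ w → Dec (P w)) → ℕ
cost H zero    x u = 4
cost H (suc k) x u = price (demand H k u λ w → ¬? (w ≟ x))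
demand H k u P? = neighbourSum H u λ w → when (P? w) (cost H k u w)

cost-≤4 : ∀ {n} (H : Graph n) k x u → cost H k x u ≤ 4
cost-≤4 H zero x u = ≤-refl
cost-≤4 H (suc k) x u = price-≤4 (demand H k u λ w → ¬? (w ≟ x))

degree-split : ∀ {n} (H : Graph n) {u v} → Adj H u v → (f : Fin n → ℕ) →
               neighbourSum H u f ≡ f v + neighbourSum H u (off v f)
degree-split H {u} {v} uv f = trans (sum-off v _)
  (cong₂ _+_ (when-yes (adj? H u v) uv)
    (sum-cong-≗ λ w → when-swap (¬? (w ≟ v)) (adj? H u w) (f w)))

module _ {n : ℕ} (H : Graph n) (π : Fin n → Fin n → 𝔽₂) where

  Proper : (Fin n → Colour) → Set
  Proper c = ∀ u v → Adj H u v → dot (c u) (c v) ≡ π u v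

-- InTree H k x u v: recolouring the neighbour u of x with cost k involves v.
data InTree {n : ℕ} (H : Graph n) : ℕ → (x u v : Fin n) → Set where
  here  : ∀ {k x u} → cost H (suc k) x u ≤ 2 → InTree H (suc k) x u u
  below : ∀ {k x u w v} → cost H (suc k) x u ≤ 2 → Adj H u w → w ≢ x →
          InTree H k u w v → InTree H (suc k) x u v

inTree? : ∀ {n} (H : Graph n) k x u v → Dec (InTree H k x u v)
inTree? H zero x u v = no λ ()
inTree? H (suc k) x u v = map′ to from
  ((cost H (suc k) x u ≤? 2) ×-dec
   ((v ≟ u) ⊎-dec any? λ w → adj? H u w ×-dec ¬? (w ≟ x) ×-dec inTree? H k u w v))
  where
  to : cost H (suc k) x u ≤ 2 × (v ≡ u ⊎ ∃ λ w → Adj H u w × w ≢ x × InTree H k u w v) →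
       InTree H (suc k) x u v
  to (r , inj₁ refl) = here r
  to (r , inj₂ (w , a , w≢x , i)) = below r a w≢x i
  from : InTree H (suc k) x u v →
         cost H (suc k) x u ≤ 2 × (v ≡ u ⊎ ∃ λ w → Adj H u w × w ≢ x × InTree H k u w v)
  from (here r) = r , inj₁ refl
  from (below r a w≢x i) = r , inj₂ (_ , a , w≢x , i)

module _ {n : ℕ} (H : Graph n) (long : LongCycles H) where

  -- At depth 1 the demand is four times the number of other neighbours, so a demand of at most 5 is
  -- at most 4.
  cost₁≤2⇒degree≤2 : ∀ {x u} → Adj H x u → cost H 1 x u ≤ 2 → degree H u ≤ 2
  cost₁≤2⇒degree≤2 {x} {u} xu c≤2 = subst (_≤ 2) (sym eq) (s≤s (ℕₚ.*-cancelˡ-≤ 4 (≤-trans (≤-reflexive four) t≤4)))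
    where
    rest = neighbourSum H u (off x λ _ → 1)
    eq : degree H u ≡ suc rest
    eq = degree-split H (Adj-sym H xu) (λ _ → 1)
    t = demand H 0 u λ w → ¬? (w ≟ x)
    four : 4 * rest ≡ t
    four = trans (*-distribˡ-sum 4 (λ w → when (adj? H u w) (off x (λ _ → 1) w)))
      (sum-cong-≗ λ w → trans (when-* (adj? H u w) 4 _)
        (when-cong (adj? H u w) λ _ → when-* (¬? (w ≟ x)) 4 1))
    t≤4 : t ≤ 4 * 1
    t≤4 with price-cases t
    ... | inj₁ (h , _) = h
    ... | inj₂ (inj₂ q) = contradiction (subst (_≤ 2) q c≤2) λ { (s≤s (s≤s ())) }
    ... | inj₂ (inj₁ (h , _)) = ℕₚ.m<1+n⇒m≤n (ℕₚ.≤∧≢⇒< h λ t≡5 → odd rest (trans (sym t≡5) (sym four)))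
      where
      odd : ∀ r → 5 ≢ 4 * r
      odd zero ()
      odd (suc zero) ()
      odd (suc (suc r)) eq = contradiction (subst (8 ≤_) (sym eq) (ℕₚ.*-monoʳ-≤ 4 (s≤s (s≤s (z≤n {r}))))) λ { (s≤s (s≤s (s≤s (s≤s (s≤s ()))))) }

  -- The last clause serves the extremal case of `trees-nonadjacent`: a vertex at full depth is
  -- recoloured at depth 1, with all its other neighbours kept, which forces degree at most 2.
  descend : ∀ {k x u v} → Adj H x u → InTree H k x u v →
            ∃ λ ℓ → ℓ ≤ k × Path H x u v ℓ × (ℓ ≡ k → degree H v ≤ 2)
  descend xu (here {k} r) = 1 , s≤s z≤n , link xu , λ { refl → cost₁≤2⇒degree≤2 xu r }
  descend xu (below r uw w≢x i) with descend uw i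
  ... | ℓ , ℓ≤k , p , d = suc ℓ , s≤s ℓ≤k , cons xu (w≢x ∘ sym) p , d ∘ ℕₚ.suc-injective

  -- The path to v prolongs, at its start, a path that enters the tree backwards.
  prolong : ∀ {k x u v s ℓ} → Adj H x u → InTree H (suc k) x u v → Path H u x s ℓ →
            ∃ λ b → ∃ λ ℓ′ → ℓ ≤ ℓ′ × ℓ′ ≤ k + ℓ × Path H v b s ℓ′ × (ℓ′ ≡ k + ℓ → degree H v ≤ 2)
  prolong {ℓ = ℓ} xu (here {k} r) p = _ , _ , ≤-refl , ℕₚ.m≤n+m ℓ k , p ,
    λ eq → cost₁≤2⇒degree≤2 xu (subst (λ k → cost H (suc k) _ _ ≤ 2) (ℕₚ.+-cancelʳ-≡ ℓ k 0 (sym eq)) r)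
  prolong {ℓ = ℓ} xu (below {suc k} r uw w≢x i) p with prolong uw i (cons (Adj-sym H uw) w≢x p)
  ... | b , ℓ′ , l , l′ , q , d = b , ℓ′ , ≤-trans (ℕₚ.n≤1+n _) l ,
    subst (ℓ′ ≤_) (ℕₚ.+-suc k ℓ) l′ , q , λ eq → d (trans eq (sym (ℕₚ.+-suc k ℓ)))

  -- Two trees of depth k at the same vertex can meet only along a cycle of length at
  -- most 2k + 1, and for length 7 only in adjacent vertices of degree at most 2.
  Separated : ℕ → Set
  Separated k = k ≤ 3 × (k ≡ 3 → ∀ {s t} → Adj H s t → degree H s ≤ 2 → ¬ degree H t ≤ 2)

  separated-pred : ∀ {k} → Separated (suc k) → Separated k
  separated-pred (h , _) = ℕₚ.<⇒≤ h , λ { refl → contradiction h ℕₚ.1+n≰n }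

  module _ {k : ℕ} {u : Fin n} (sep : Separated k) where

    private
      k≤3 = proj₁ sep

    root∉tree : ∀ {w} → Adj H u w → ¬ InTree H k u w u
    root∉tree uw i with descend uw i
    ... | ℓ , ℓ≤k , p , _ = path-open H long p (≤-trans ℓ≤k (≤-trans k≤3 (s≤s (s≤s (s≤s z≤n))))) refl

    tree-attached : ∀ {w s} → Adj H u w → InTree H k u w s → Adj H u s → s ≡ w
    tree-attached uw i us with descend uw i
    ... | _ , _ , link _ , _ = refl
    ... | _ , ℓ≤k , p@(cons _ _ q) , _ = ⊥-elim (path-nonadjacent H long p (s≤s (path-positive H q))
      (≤-trans ℓ≤k (≤-trans k≤3 (s≤s (s≤s (s≤s z≤n))))) us)

    module _ {w w′ s t : Fin n} (uw : Adj H u w) (i : InTree H k u w s)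
             (uw′ : Adj H u w′) (i′ : InTree H k u w′ t) where

      -- A common vertex would close the walk through `u` along both trees, of length at most 2k and
      -- so at most 6.
      trees-disjoint : s ≡ t → w ≡ w′
      trees-disjoint s≡t with w ≟ w′
      ... | yes eq = eq
      ... | no ne = ⊥-elim (meet i′ k≤3)
        where
        meet : ∀ {j} → InTree H j u w′ t → j ≤ 3 → ⊥
        meet {suc j} i′ j≤3 with descend uw i
        ... | ℓ , ℓ≤k , p , _ with prolong uw′ i′ (cons (Adj-sym H uw′) (ne ∘ sym) p)
        ... | b , ℓ′ , _ , l , q , _ = path-open H long q
          (≤-trans l (+-mono-≤ (ℕₚ.≤-pred j≤3) (s≤s (≤-trans ℓ≤k k≤3)))) (sym s≡t)

      -- The edge `st` closes the walk along both trees to a length of at most 2k + 1. Length 7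
      -- needs k = 3 and both `s` and `t` at full depth, where their degrees are at most 2;
      -- `Separated` excludes that.
      trees-nonadjacent : Adj H s t → w ≡ w′
      trees-nonadjacent st with w ≟ w′
      ... | yes eq = eq
      ... | no ne = ⊥-elim (meet i′ refl)
        where
        meet : ∀ {j} → InTree H j u w′ t → j ≡ k → ⊥
        meet {suc j} i′ refl with descend uw i
        ... | ℓ , ℓ≤k , p , d with prolong uw′ i′ (cons (Adj-sym H uw′) (ne ∘ sym) p)
        ... | b , ℓ′ , 1+ℓ≤ℓ′ , l , q , d′ with ℓ′ ≤? 5
        ... | yes ℓ′≤5 = path-nonadjacent H long q (≤-trans (s≤s (path-positive H p)) 1+ℓ≤ℓ′) ℓ′≤5 (Adj-sym H st)
        ... | no ℓ′≰5 = proj₂ sep k≡3 st (d ℓ≡k) (d′ (ℕₚ.≤-antisym l (≤-trans (+-mono-≤ (ℕₚ.≤-pred k≤3) (s≤s (≤-trans ℓ≤k k≤3))) 6≤ℓ′)))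
          where
          6≤ℓ′ : 6 ≤ ℓ′
          6≤ℓ′ = ℕₚ.≰⇒> ℓ′≰5
          k≡3 : suc j ≡ 3
          k≡3 with ℕₚ.m≤n⇒m<n∨m≡n k≤3
          ... | inj₂ eq = eq
          ... | inj₁ (s≤s k≤2) = contradiction (≤-trans 6≤ℓ′ (≤-trans l (+-mono-≤ (ℕₚ.≤-pred k≤2) (s≤s (≤-trans ℓ≤k k≤2))))) λ { (s≤s (s≤s (s≤s (s≤s ())))) }
          ℓ≡k : ℓ ≡ suc j
          ℓ≡k with ℕₚ.m≤n⇒m<n∨m≡n ℓ≤k
          ... | inj₂ eq = eq
          ... | inj₁ ℓ<k = contradiction (≤-trans 6≤ℓ′ (≤-trans l (+-mono-≤ (ℕₚ.≤-pred k≤3) (≤-trans ℓ<k k≤3)))) λ { (s≤s (s≤s (s≤s (s≤s (s≤s ()))))) }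

-- Recolouring a tree

module _ {n : ℕ} (H : Graph n) (long : LongCycles H)
         (π : Fin n → Fin n → 𝔽₂) (π-sym : ∀ u v → π u v ≡ π v u) (c : Fin n → Colour) where

  -- Blocked k x u q: if x gets colour q, then the recolouring of u and its tree fails.
  Blocked : ℕ → (x u : Fin n) → Colour → Set
  Available : ℕ → (x u : Fin n) → Colour → Set
  Blocked zero    x u q = Misses (π x u) q (c u)
  Blocked (suc k) x u q =
    (cost H (suc k) x u ≤ 2 × MissesAll′ ) ⊎ (¬ cost H (suc k) x u ≤ 2 × Misses (π x u) q (c u))
    where
    MissesAll′ = ∀ p → Available k x u p → Misses (π x u) q p
  Available k x u p = ∀ w → Adj H u w → w ≢ x → ¬ Blocked k u w p

  blocked? : ∀ k x u q → Dec (Blocked k x u q)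
  available? : ∀ k x u p → Dec (Available k x u p)
  blocked? zero    x u q = misses? (π x u) q (c u)
  blocked? (suc k) x u q =
    ((cost H (suc k) x u ≤? 2) ×-dec missesAll? (available? k x u) (π x u) q) ⊎-dec
    (¬? (cost H (suc k) x u ≤? 2) ×-dec misses? (π x u) q (c u))
  available? k x u p = all? λ w → adj? H u w →-dec ¬? (w ≟ x) →-dec ¬? (blocked? k u w p)

  module _ (k : ℕ) (u : Fin n) {P : Fin n → Set} (P? : ∀ w → Dec (P w)) where

    Free : Colour → Set
    Free p = ∀ w → Adj H u w → P w → ¬ Blocked k u w p

    free? : ∀ p → Dec (Free p)
    free? p = all? λ w → adj? H u w →-dec P? w →-dec ¬? (blocked? k u w p)

  -- Simultaneous induction with `free-count`: a demand t leaves at least 7 - t available colours at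
  -- `u`, and two or three of these reduce the blocked colours of `x` to 2 or 1.
  blocked-count : ∀ k x u → count (blocked? k x u) ≤ cost H k x u
  -- Each of the seven colours is free or blocked by some neighbour; the blocking pairs are counted
  -- neighbour by neighbour.
  free-count : ∀ k u {P : Fin n → Set} (P? : ∀ w → Dec (P w)) →
               7 ≤ count (free? k u P?) + demand H k u P?
  blocked-count zero x u = misses-one (π x u) (c u)
  blocked-count (suc k) x u = by-price (price-cases t)
    where
    t = demand H k u λ w → ¬? (w ≟ x)
    free : 7 ≤ count (available? k x u) + t
    free = free-count k u λ w → ¬? (w ≟ x)
    fewer : ∀ {a b} → 7 ≤ a + t → t ≤ b → 7 ∸ b ≤ a
    fewer {a} {b} h t≤b = ℕₚ.m≤n+o⇒m∸n≤o 7 b (≤-trans h (subst (a + t ≤_) (ℕₚ.+-comm a b) (ℕₚ.+-monoʳ-≤ a t≤b)))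
    recoloured : price t ≤ 2 → count (blocked? (suc k) x u) ≤ count (missesAll? (available? k x u) (π x u))
    recoloured r = count-mono (blocked? (suc k) x u) (missesAll? (available? k x u) (π x u))
      λ { q (inj₁ (_ , m)) → m ; q (inj₂ (kept , _)) → contradiction r kept }
    by-price : (t ≤ 4 × price t ≡ 1) ⊎ (t ≤ 5 × price t ≡ 2) ⊎ price t ≡ 4 →
               count (blocked? (suc k) x u) ≤ price t
    by-price (inj₁ (t≤4 , eq)) = subst (count (blocked? (suc k) x u) ≤_) (sym eq)
      (≤-trans (recoloured (subst (_≤ 2) (sym eq) (s≤s z≤n)))
        (missesAll-≤1 (available? k x u) (π x u) (fewer free t≤4)))
    by-price (inj₂ (inj₁ (t≤5 , eq))) = subst (count (blocked? (suc k) x u) ≤_) (sym eq)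
      (≤-trans (recoloured (subst (_≤ 2) (sym eq) ≤-refl))
        (missesAll-≤2 (available? k x u) (π x u) (fewer free t≤5)))
    by-price (inj₂ (inj₂ eq)) = subst (count (blocked? (suc k) x u) ≤_) (sym eq)
      (≤-trans (count-mono (blocked? (suc k) x u) (λ q → misses? (π x u) q (c u)) λ
        { q (inj₁ (r , _)) → contradiction (subst (_≤ 2) eq r) λ { (s≤s (s≤s ())) }
        ; q (inj₂ (_ , m)) → m })
        (misses-one (π x u) (c u)))

  free-count k u {P} P? = begin
    7                                                           ≡⟨ sym (sum-const 7 1) ⟩
    sum {7} (λ _ → 1)                                           ≤⟨ sum-mono pointwise ⟩
    sum (λ p → when (free? k u P? p) 1 + sum (λ w → hit w p))   ≡⟨ ∑-distrib-+ (λ p → when (free? k u P? p) 1) (λ p → sum (λ w → hit w p)) ⟩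
    count (free? k u P?) + sum (λ p → sum (λ w → hit w p))      ≡⟨ cong (count (free? k u P?) +_) (∑-comm λ p w → hit w p) ⟩
    count (free? k u P?) + sum (λ w → sum (λ p → hit w p))      ≤⟨ ℕₚ.+-monoʳ-≤ (count (free? k u P?)) (sum-mono column) ⟩
    count (free? k u P?) + demand H k u P?                      ∎
    where
    open ℕₚ.≤-Reasoning
    hit : Fin n → Colour → ℕ
    hit w p = when (adj? H u w) (when (P? w) (when (blocked? k u w p) 1))
    pointwise : ∀ p → 1 ≤ when (free? k u P? p) 1 + sum (λ w → hit w p)
    pointwise p = helper (any? λ w → adj? H u w ×-dec P? w ×-dec blocked? k u w p)
      where
      helper : Dec (∃ λ w → Adj H u w × P w × Blocked k u w p) → _
      helper (yes (w , a , Pw , b)) = ≤-trans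
        (≤-reflexive (sym (trans (when-yes (adj? H u w) a) (trans (when-yes (P? w) Pw) (when-yes (blocked? k u w p) b)))))
        (≤-trans (sum-≥ (λ w → hit w p) w) (ℕₚ.m≤n+m _ _))
      helper (no none) = ≤-trans
        (≤-reflexive (sym (when-yes (free? k u P? p) λ w a Pw b → none (w , a , Pw , b))))
        (m≤m+n _ _)
    column : ∀ w → sum (λ p → hit w p) ≤ when (adj? H u w) (when (P? w) (cost H k u w))
    column w = begin
      sum (λ p → hit w p)                                            ≡⟨ pull (adj? H u w) (λ p → when (P? w) (when (blocked? k u w p) 1)) ⟩
      when (adj? H u w) (sum λ p → when (P? w) (when (blocked? k u w p) 1)) ≡⟨ cong (when (adj? H u w)) (pull (P? w) (λ p → when (blocked? k u w p) 1)) ⟩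
      when (adj? H u w) (when (P? w) (count (blocked? k u w)))       ≤⟨ when-mono (adj? H u w) (adj? H u w) id (λ _ → when-mono (P? w) (P? w) id λ _ → blocked-count k u w) ⟩
      when (adj? H u w) (when (P? w) (cost H k u w))                 ∎
      where
      pull : {Q : Set} (d : Dec Q) (f : Colour → ℕ) → sum (λ p → when d (f p)) ≡ when d (sum f)
      pull (yes _) f = refl
      pull (no _)  f = refl

  Region : ℕ → (u : Fin n) → (Fin n → Set) → Fin n → Set
  Region k u P s = s ≡ u ⊎ ∃ λ w → Adj H u w × P w × InTree H k u w s

  -- The colour `q` of `x` is only intended, `f` need not assign it. Hence the edge from `u` to `x`
  -- is tested against `q` separately and is exempt from the last clause.
  Recolouring : ℕ → (x u : Fin n) → Colour → (Fin n → Colour) → Set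
  Recolouring k x u q f =
    (∀ v → ¬ InTree H k x u v → f v ≡ c v) ×
    dot q (f u) ≡ π x u ×
    (∀ s t → InTree H k x u s → Adj H s t → (s ≡ u → t ≢ x) → dot (f s) (f t) ≡ π s t)

  -- `P` selects the neighbours below `u`: all but the vertex above it, and all of them at the root
  -- of the whole tree.
  RootedRecolouring : ℕ → (u : Fin n) → (Fin n → Set) → Colour → (Fin n → Colour) → Set
  RootedRecolouring k u P p f =
    f u ≡ p ×
    (∀ v → ¬ Region k u P v → f v ≡ c v) ×
    (∀ s t → Region k u P s → Adj H s t → (s ≡ u → P t) → dot (f s) (f t) ≡ π s t)

  -- Every vertex takes its colour from the one tree that contains it. The delicate edges lead from
  -- a tree to a vertex other than `u` outside it: as different trees are not adjacent, that vertex
  -- lies in no other tree either and still has the colour that the solution for this tree relied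
  -- on.
  glue : ∀ {k u} → Separated H long k → {P : Fin n → Set} → (∀ w → Dec (P w)) → ∀ p →
         (∀ w → ∃ λ f → Adj H u w → P w → Recolouring k u w p f) →
         ∃ (RootedRecolouring k u P p)
  glue {k} {u} sep {P} P? p sol = f , f-root (u ≟ u) (owner? u) refl , f-outside , f-good
    where
    Owner : Fin n → Fin n → Set
    Owner v w = Adj H u w × P w × InTree H k u w v
    owner? : ∀ v → Dec (∃ (Owner v))
    owner? v = any? λ w → adj? H u w ×-dec P? w ×-dec inTree? H k u w v
    F : Fin n → Fin n → Colour
    F w = proj₁ (sol w)
    pick : ∀ {v} → Dec (v ≡ u) → Dec (∃ (Owner v)) → Colour
    pick (yes _) _ = p
    pick {v} (no _) (yes (w , _)) = F w v
    pick {v} (no _) (no _) = c v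
    f : Fin n → Colour
    f v = pick (v ≟ u) (owner? v)
    f-root : ∀ {v} (d : Dec (v ≡ u)) (e : Dec (∃ (Owner v))) → v ≡ u → pick d e ≡ p
    f-root (yes _) _ _ = refl
    f-root (no ne) _ eq = contradiction eq ne
    f-outside : ∀ v → ¬ Region k u P v → f v ≡ c v
    f-outside v out with v ≟ u | owner? v
    ... | yes eq | _ = contradiction (inj₁ eq) out
    ... | no _ | yes o = contradiction (inj₂ o) out
    ... | no _ | no _ = refl
    f-inside : ∀ {v w} → Owner v w → f v ≡ F w v
    f-inside {v} {w} (a , Pw , i) with v ≟ u | owner? v
    ... | yes refl | _ = contradiction i (root∉tree H long sep a)
    ... | no _ | yes (w′ , a′ , _ , i′) = cong (λ w → F w v) (trees-disjoint H long sep a′ i′ a i refl)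
    ... | no _ | no none = contradiction (w , a , Pw , i) none
    f-kept : ∀ {v w} → Adj H u w → P w → (v ≢ u) → ¬ InTree H k u w v → (∀ {w′} → Owner v w′ → w ≡ w′) → f v ≡ F w v
    f-kept {v} {w} a Pw v≢u i only with v ≟ u | owner? v
    ... | yes eq | _ = contradiction eq v≢u
    ... | no _ | yes (w′ , o) = contradiction (subst (λ w → InTree H k u w v) (sym (only o)) (proj₂ (proj₂ o))) i
    ... | no _ | no _ = sym (proj₁ (proj₂ (sol w) a Pw) v i)
    f-child : ∀ {w} → Adj H u w → P w → f w ≡ F w w
    f-child {w} a Pw with inTree? H k u w w
    ... | yes i = f-inside (a , Pw , i)
    ... | no i = f-kept a Pw (λ { refl → adj-irrefl H a }) i λ (a′ , _ , i′) → tree-attached H long sep a′ i′ a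
    f-edge : ∀ {t} → Adj H u t → P t → dot p (f t) ≡ π u t
    f-edge {t} a Pt = trans (cong (dot p) (f-child a Pt)) (proj₁ (proj₂ (proj₂ (sol t) a Pt)))
    f-good : ∀ s t → Region k u P s → Adj H s t → (s ≡ u → P t) → dot (f s) (f t) ≡ π s t
    f-good s t (inj₁ refl) a h = trans (cong (λ q → dot q (f t)) (f-root (u ≟ u) (owner? u) refl)) (f-edge a (h refl))
    f-good s t (inj₂ (w , uw , Pw , i)) a h = by-end (t ≟ u)
      where
      s≡w : t ≡ u → s ≡ w
      s≡w refl = tree-attached H long sep uw i (Adj-sym H a)
      f-t : t ≢ u → f t ≡ F w t
      f-t t≢u with inTree? H k u w t
      ... | yes j = f-inside (uw , Pw , j)
      ... | no j = f-kept uw Pw t≢u j λ (a′ , _ , i′) → trees-nonadjacent H long sep uw i a′ i′ a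
      by-end : Dec (t ≡ u) → dot (f s) (f t) ≡ π s t
      by-end (no t≢u) = trans (cong₂ dot (f-inside (uw , Pw , i)) (f-t t≢u))
        (proj₂ (proj₂ (proj₂ (sol w) uw Pw)) s t i a λ _ → t≢u)
      by-end (yes t≡u) = subst₂ (λ s t → dot (f s) (f t) ≡ π s t) (sym (s≡w t≡u)) (sym t≡u)
        (trans (cong (dot (f w)) (f-root (u ≟ u) (owner? u) refl))
          (trans (dot-comm (f w) p) (trans (f-edge uw Pw) (π-sym u w))))

  recolour : ∀ {k x u q} → Separated H long k → ¬ Blocked k x u q → ∃ (Recolouring k x u q)
  recolourRoot : ∀ {k u} → Separated H long k → {P : Fin n → Set} (P? : ∀ w → Dec (P w)) → ∀ p →
                 Free k u P? p → ∃ (RootedRecolouring k u P p)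
  recolour {zero} {x} {u} {q} sep free = c , (λ _ _ → refl) ,
    decidable-stable (dot q (c u) ℙₚ.≟ π x u) free , λ _ _ ()
  recolour {suc k} {x} {u} {q} sep free with cost H (suc k) x u ≤? 2
  ... | no kept = c , (λ _ _ → refl) ,
    decidable-stable (dot q (c u) ℙₚ.≟ π x u) (λ m → free (inj₂ (kept , m))) ,
    λ { _ _ (here r) → contradiction r kept ; _ _ (below r _ _ _) → contradiction r kept }
  ... | yes r with any? (λ p → available? k x u p ×-dec (dot q p ℙₚ.≟ π x u))
  ... | no none = contradiction (inj₁ (r , λ p av eq → none (p , av , eq))) free
  ... | yes (p , av , eq) with recolourRoot (separated-pred H long sep) (λ w → ¬? (w ≟ x)) p av
  ... | f , root , outside , good = f ,
    (λ v v∉ → outside v λ { (inj₁ refl) → v∉ (here r) ; (inj₂ (w , a , w≢x , i)) → v∉ (below r a w≢x i) }) ,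
    trans (cong (dot q) root) eq ,
    λ { s t (here _) → good s t (inj₁ refl) ; s t (below _ a w≢x i) → good s t (inj₂ (_ , a , w≢x , i)) }
  recolourRoot {k} {u} sep {P} P? p free = glue sep P? p solve′
    where
    solve′ : ∀ w → ∃ λ f → Adj H u w → P w → Recolouring k u w p f
    solve′ w with adj? H u w ×-dec P? w
    ... | yes (a , Pw) = let f , r = recolour sep (free w a Pw) in f , λ _ _ → r
    ... | no ¬aP = c , λ a Pw → contradiction (a , Pw) ¬aP

  -- At most six of the seven colours of `r` are blocked, so one is free; the trees at `r` are then
  -- recoloured to suit it.
  tree-extension : ∀ {k r} → Separated H long k →
    (∀ u v → Adj H u v → u ≢ r → v ≢ r → dot (c u) (c v) ≡ π u v) →
    neighbourSum H r (cost H k r) ≤ 6 → ∃ (Proper H π)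
  tree-extension {k} {r} sep proper few = extend (recolourRoot sep all-nbrs p free)
    where
    all-nbrs : ∀ (w : Fin n) → Dec ⊤
    all-nbrs w = yes tt
    some : ∃ (Free k r all-nbrs)
    some = count-witness (free? k r all-nbrs)
      (ℕₚ.+-cancelʳ-≤ 6 1 _ (≤-trans (free-count k r all-nbrs) (ℕₚ.+-monoʳ-≤ (count (free? k r all-nbrs)) few)))
    p = proj₁ some
    free = proj₂ some
    extend : ∃ (RootedRecolouring k r (λ _ → ⊤) p) → ∃ (Proper H π)
    extend (f , root , outside , good) = f , proper′
      where
      region? : ∀ v → Dec (Region k r (λ _ → ⊤) v)
      region? v = (v ≟ r) ⊎-dec any? λ w → adj? H r w ×-dec yes tt ×-dec inTree? H k r w v
      proper′ : Proper H π f
      proper′ s t a with region? s | region? t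
      ... | yes i | _ = good s t i a _
      ... | no _ | yes j = trans (dot-comm (f s) (f t)) (trans (good t s j (Adj-sym H a) _) (π-sym t s))
      ... | no i | no j = trans (cong₂ dot (outside s i) (outside t j))
        (proper s t a (i ∘ inj₁) (j ∘ inj₁))

-- Discharging

module _ {n : ℕ} (H : Graph n) (u : Fin n) where

  private
    Σₙ = neighbourSum H u

  neighbourSum-mono : ∀ {f g} → (∀ w → Adj H u w → f w ≤ g w) → Σₙ f ≤ Σₙ g
  neighbourSum-mono h = sum-mono λ w → when-mono (adj? H u w) (adj? H u w) id (h w)

  neighbourSum-* : ∀ k f → k * Σₙ f ≡ Σₙ (λ w → k * f w)
  neighbourSum-* k f = trans (*-distribˡ-sum k (λ w → when (adj? H u w) (f w)))
    (sum-cong-≗ λ w → when-* (adj? H u w) k (f w))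

  neighbourSum-+ : ∀ f g → Σₙ (λ w → f w + g w) ≡ Σₙ f + Σₙ g
  neighbourSum-+ f g = trans (sum-cong-≗ λ w → when-+ (adj? H u w) (f w) (g w))
    (∑-distrib-+ (λ w → when (adj? H u w) (f w)) (λ w → when (adj? H u w) (g w)))

  neighbourSum-bound : ∀ {f} k → (∀ w → Adj H u w → f w ≤ k) → Σₙ f ≤ k * degree H u
  neighbourSum-bound {f} k h = subst (Σₙ f ≤_) (sym (neighbourSum-* k λ _ → 1))
    (neighbourSum-mono λ w a → subst (f w ≤_) (sym (ℕₚ.*-identityʳ k)) (h w a))

  neighbourSum-≥ : ∀ {w} f → Adj H u w → f w ≤ Σₙ f
  neighbourSum-≥ {w} f a = subst (_≤ Σₙ f) (when-yes (adj? H u w) a) (sum-≥ (λ w → when (adj? H u w) (f w)) w)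

  private
    one : Fin n → ℕ
    one _ = 1

    off-self : ∀ {a} (f : Fin n → ℕ) → off a f a ≡ 0
    off-self {a} f = when-no (¬? (a ≟ a)) (λ h → h refl)

    off-other : ∀ {a b} (f : Fin n → ℕ) → b ≢ a → off a f b ≡ f b
    off-other {a} {b} f b≢a = when-yes (¬? (b ≟ a)) b≢a

    off-scale : ∀ {M a} {f g : Fin n → ℕ} → (∀ w → f w ≤ M * g w) → ∀ w → off a f w ≤ M * off a g w
    off-scale {M} {a} {f} {g} h w = subst (off a f w ≤_) (sym (when-* (¬? (w ≟ a)) M (g w)))
      (when-mono (¬? (w ≟ a)) (¬? (w ≟ a)) id λ _ → h w)

    f≤sum*one : ∀ f w → f w ≤ sum f * one w
    f≤sum*one f w = subst (f w ≤_) (sym (ℕₚ.*-identityʳ (sum f))) (sum-≥ f w)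

    vanish : ∀ {M f g} → (∀ w → f w ≤ M * g w) → Σₙ g ≡ 0 → Σₙ f ≡ 0
    vanish {M} {f} {g} h eq = ℕₚ.n≤0⇒n≡0 (begin
      Σₙ f               ≤⟨ neighbourSum-mono (λ w _ → h w) ⟩
      Σₙ (λ w → M * g w) ≡⟨ sym (neighbourSum-* M g) ⟩
      M * Σₙ g           ≡⟨ cong (M *_) eq ⟩
      M * 0              ≡⟨ ℕₚ.*-zeroʳ M ⟩
      0                  ∎)
      where open ℕₚ.≤-Reasoning

    positive-off : ∀ {a w} {f : Fin n → ℕ} → 1 ≤ off a f w → w ≢ a × 1 ≤ f w
    positive-off {a} {w} {f} h = ne , subst (1 ≤_) (when-yes (¬? (w ≟ a)) ne) h
      where ne = when-positive (¬? (w ≟ a)) h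

    witness : ∀ {f} → 1 ≤ Σₙ f → ∃ λ w → Adj H u w × 1 ≤ f w
    witness {f} h = let w , q = sum-witness _ h
                        a = when-positive (adj? H u w) q
                    in w , a , subst (1 ≤_) (when-yes (adj? H u w) a) q

  neighbour : Positive H u → ∃ λ a → Adj H u a
  neighbour h = let a , ua , _ = witness h in a , ua

  another : ∀ {d a} → degree H u ≡ suc (suc d) → Adj H u a → ∃ λ b → Adj H u b × b ≢ a
  another {d} {a} deg ua = let b , ub , q = witness {off a one} rest in b , ub , proj₁ (positive-off {a} {f = one} q)
    where
    rest : 1 ≤ Σₙ (off a one)
    rest = subst (1 ≤_) (ℕₚ.suc-injective (trans (sym deg) (degree-split H ua one))) (s≤s z≤n)

  -- Neighbourhoods are handed over as a formula for sums over them, valid for every summand; costs,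
  -- gifts and, in `third-neighbour`, the indicator of a vertex are substituted later.
  two-neighbours : ∀ {a} → degree H u ≡ 2 → Adj H u a →
    ∃ λ b → Adj H u b × b ≢ a × (∀ f → Σₙ f ≡ f a + f b)
  two-neighbours {a} deg ua = b , ub , b≢a , formula
    where
    b-data = another deg ua
    b = proj₁ b-data
    ub = proj₁ (proj₂ b-data)
    b≢a = proj₂ (proj₂ b-data)
    split : ∀ f → Σₙ f ≡ f a + (f b + Σₙ (off b (off a f)))
    split f = trans (degree-split H ua f) (cong (f a +_)
      (trans (degree-split H ub (off a f)) (cong (_+ Σₙ (off b (off a f))) (off-other f b≢a))))
    none : Σₙ (off b (off a one)) ≡ 0
    none = ℕₚ.+-cancelˡ-≡ 2 _ 0 (trans (sym (split one)) deg)
    formula : ∀ f → Σₙ f ≡ f a + f b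
    formula f = trans (split f) (cong (f a +_) (trans
      (cong (f b +_) (vanish {sum f} (off-scale {sum f} {b} {off a f} {off a one} (off-scale {sum f} {a} {f} {one} (f≤sum*one f))) none))
      (ℕₚ.+-identityʳ (f b))))

  three-neighbours : ∀ {a b} → degree H u ≡ 3 → Adj H u a → Adj H u b → b ≢ a →
    ∃ λ c → Adj H u c × c ≢ a × c ≢ b × (∀ f → Σₙ f ≡ f a + (f b + f c))
  three-neighbours {a} {b} deg ua ub b≢a = c , uc , c≢a , c≢b , formula
    where
    split₂ : ∀ f → Σₙ f ≡ f a + (f b + Σₙ (off b (off a f)))
    split₂ f = trans (degree-split H ua f) (cong (f a +_)
      (trans (degree-split H ub (off a f)) (cong (_+ Σₙ (off b (off a f))) (off-other f b≢a))))
    rest : 1 ≤ Σₙ (off b (off a one))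
    rest = ≤-reflexive (ℕₚ.+-cancelˡ-≡ 2 _ _ (trans (sym deg) (split₂ one)))
    c-data = witness {off b (off a one)} rest
    c = proj₁ c-data
    uc = proj₁ (proj₂ c-data)
    c-off-b = positive-off {b} {f = off a one} (proj₂ (proj₂ c-data))
    c≢b = proj₁ c-off-b
    c≢a = proj₁ (positive-off {a} {f = one} (proj₂ c-off-b))
    split : ∀ f → Σₙ f ≡ f a + (f b + (f c + Σₙ (off c (off b (off a f)))))
    split f = trans (split₂ f) (cong (λ z → f a + (f b + z))
      (trans (degree-split H uc (off b (off a f))) (cong (_+ Σₙ (off c (off b (off a f))))
        (trans (off-other (off a f) c≢b) (off-other f c≢a)))))
    none : Σₙ (off c (off b (off a one))) ≡ 0
    none = ℕₚ.+-cancelˡ-≡ 3 _ 0 (trans (sym (split one)) deg)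
    formula : ∀ f → Σₙ f ≡ f a + (f b + f c)
    formula f = trans (split f) (cong (λ z → f a + (f b + z)) (trans
      (cong (f c +_) (vanish {sum f} (off-scale {sum f} {c} {off b (off a f)} {off b (off a one)} (off-scale {sum f} {b} {off a f} {off a one} (off-scale {sum f} {a} {f} {one} (f≤sum*one f)))) none))
      (ℕₚ.+-identityʳ (f c))))

  third-neighbour : ∀ {a b c w} → (∀ f → Σₙ f ≡ f a + (f b + f c)) → Adj H u w → w ≢ a → w ≢ b → w ≡ c
  third-neighbour {a} {b} {c} {w} formula uw w≢a w≢b = sym (when-positive (c ≟ w) (begin
    1                                        ≡⟨ sym (when-yes (w ≟ w) refl) ⟩
    is-w w                                   ≤⟨ neighbourSum-≥ is-w uw ⟩
    Σₙ is-w                                  ≡⟨ formula is-w ⟩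
    is-w a + (is-w b + is-w c)               ≡⟨ cong₂ (λ x y → x + (y + is-w c)) (when-no (a ≟ w) (w≢a ∘ sym)) (when-no (b ≟ w) (w≢b ∘ sym)) ⟩
    is-w c                                   ∎))
    where
    open ℕₚ.≤-Reasoning
    is-w : Fin n → ℕ
    is-w z = when (z ≟ w) 1

  off-two : ∀ {a b} f → b ≢ a → (∀ f → Σₙ f ≡ f a + f b) → Σₙ (off a f) ≡ f b
  off-two {a} f b≢a formula = trans (formula (off a f)) (cong₂ _+_ (off-self {a} f) (off-other f b≢a))

  off-three : ∀ {a b c} f → b ≢ a → c ≢ a → (∀ f → Σₙ f ≡ f a + (f b + f c)) →
              Σₙ (off a f) ≡ f b + f c
  off-three {a} f b≢a c≢a formula = trans (formula (off a f))
    (cong₂ _+_ (off-self {a} f) (cong₂ _+_ (off-other f b≢a) (off-other f c≢a)))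

rest-of : ∀ {s t p q} → p ≤ s → t ≤ p + q → t ∸ s ≤ q
rest-of {s} {t} {p} {q} p≤s h = ℕₚ.m≤n+o⇒m∸n≤o t s (≤-trans h (ℕₚ.+-monoˡ-≤ q p≤s))

rest-≥3 : ∀ {p q} → 7 ≤ p + q → q ≤ 4 → 3 ≤ p
rest-≥3 {p} {q} h q≤4 = rest-of q≤4 (subst (7 ≤_) (ℕₚ.+-comm p q) h)

-- Three times the remaining charge 10d - 28 - g is at least 14(d - 4).
charge-≥4 : ∀ {g c d i} → 3 * g + 4 * c ≤ 16 * d → 7 ≤ c → 4 ≤ d → 28 + g ≤ 10 * d + i
charge-≥4 {g} {c} {d} {i} linear 7≤c 4≤d = ≤-trans
  (ℕₚ.*-cancelˡ-≤ 3 (farkas (3 * (28 + g)) (3 * (10 * d)) 0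
    (+-mono-≤ (+-mono-≤ linear (ℕₚ.*-monoʳ-≤ 4 7≤c)) (ℕₚ.*-monoʳ-≤ 14 4≤d)) (identity g c d)))
  (m≤m+n (10 * d) i)
  where
  identity : ∀ g c d → 3 * (28 + g) + (16 * d + 4 * c + 14 * d) + 0 ≡ 3 * (10 * d) + (3 * g + 4 * c + 4 * 7 + 14 * 4)
  identity = solve-∀

charge-2 : ∀ {d g i} → d ≡ 2 → g ≡ 0 → i ≡ 8 → 28 + g ≤ 10 * d + i
charge-2 refl refl refl = ≤-refl

charge-3 : ∀ {d g g′ i i′} → d ≡ 3 → g ≡ g′ → i ≡ i′ → g′ ≤ 2 + i′ → 28 + g ≤ 10 * d + i
charge-3 refl refl refl h = ℕₚ.+-monoʳ-≤ 28 h

module _ {n : ℕ} (H : Graph n) (κ : ℕ → Fin n → Fin n → ℕ) (κ≤4 : ∀ k x u → κ k x u ≤ 4)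
         (κ-suc : ∀ k x u → κ (suc k) x u ≡ price (neighbourSum H u (off x (κ k u)))) where

  -- A `Bad` vertex has charge 2 but owes 4 to its neighbour of degree 2, so it lacks 2.
  Two Bad : Fin n → Set
  Two u = degree H u ≡ 2
  Bad u = degree H u ≡ 3 × ∃ λ v → Adj H u v × Two v

  -- A bad `y` gets nothing from another bad vertex, so under `OtherBad` the vertex `x` alone has to
  -- supply the missing 2. A `Weak` vertex may owe 3 to its two bad neighbours while its charge is
  -- 2, so `x` has to help.
  OtherBad Weak : Fin n → Fin n → Set
  OtherBad x y = ∃ λ w → Adj H y w × w ≢ x × Bad w
  Weak x y = degree H y ≡ 3 × (∀ w → Adj H y w → w ≢ x → Bad w)

  two? : ∀ u → Dec (Two u)
  two? u = degree H u ℕₚ.≟ 2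

  bad? : ∀ u → Dec (Bad u)
  bad? u = (degree H u ℕₚ.≟ 3) ×-dec any? λ v → adj? H u v ×-dec two? v

  otherBad? : ∀ x y → Dec (OtherBad x y)
  otherBad? x y = any? λ w → adj? H y w ×-dec ¬? (w ≟ x) ×-dec bad? w

  weak? : ∀ x y → Dec (Weak x y)
  weak? x y = (degree H y ℕₚ.≟ 3) ×-dec all? λ w → adj? H y w →-dec ¬? (w ≟ x) →-dec bad? w

  -- A vertex of degree 2 lacks 8 and gets 4 from either side. A bad vertex gets its missing 2 from
  -- neighbours that are neither bad nor of degree 2, as 1 + 1 or all from one of them.
  giftBy : {A B C D E : Set} → Dec A → Dec B → Dec C → Dec D → Dec E → ℕ
  giftBy (yes _) _       _       _       _       = 4
  giftBy (no _)  (yes _) (yes _) _       _       = 0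
  giftBy (no _)  (yes _) (no _)  (yes _) _       = 2
  giftBy (no _)  (yes _) (no _)  (no _)  _       = 1
  giftBy (no _)  (no _)  _       _       (yes _) = 1
  giftBy (no _)  (no _)  _       _       (no _)  = 0

  -- Discharging with initial charge 10 deg u − 28: the vertex x gives gift x y to
  -- its neighbour y.
  gift : Fin n → Fin n → ℕ
  gift x y = giftBy (two? y) (bad? y) (two? x ⊎-dec bad? x) (otherBad? x y) (weak? x y)

  two-not-three : ∀ {u} → degree H u ≡ 3 → ¬ Two u
  two-not-three eq t = contradiction (trans (sym eq) t) λ ()

  κ-≤1 : ∀ {k x u t} → neighbourSum H u (off x (κ k u)) ≡ t → t ≤ 4 → κ (suc k) x u ≤ 1
  κ-≤1 {k} {x} {u} refl h = ≤-reflexive (trans (κ-suc k x u) (price-1 h))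

  κ-≤2 : ∀ {k x u t} → neighbourSum H u (off x (κ k u)) ≡ t → t ≤ 5 → κ (suc k) x u ≤ 2
  κ-≤2 {k} {x} {u} refl h = subst (_≤ 2) (sym (κ-suc k x u)) (price-≤2 h)

  -- In this and the next three lemmas the demand is at most 4, 1 + 4, 1 + 2 and 2 + 2, each built
  -- on costs one level down; the last two reach depth 3.
  cost-two : ∀ {k x v} → Adj H x v → Two v → κ (suc k) x v ≤ 1
  cost-two {k} {x} {v} xv tv =
    let b , _ , b≢x , formula = two-neighbours H v tv (Adj-sym H xv)
    in κ-≤1 (off-two H v (κ k v) b≢x formula) (κ≤4 k v b)

  cost-bad : ∀ {k x y} → Adj H x y → Bad y → ¬ Two x → κ (suc (suc k)) x y ≤ 2
  cost-bad {k} {x} {y} xy (d3 , v , yv , tv) ¬tx =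
    let v≢x = λ { refl → ¬tx tv }
        c , _ , c≢x , _ , formula = three-neighbours H y d3 (Adj-sym H xy) yv v≢x
    in κ-≤2 (off-three H y (κ (suc k) y) v≢x c≢x formula) (+-mono-≤ (cost-two yv tv) (κ≤4 (suc k) y c))

  cost-pair : ∀ {k x y} → Adj H x y → Bad y → ¬ Two x → OtherBad x y → κ (suc (suc (suc k))) x y ≤ 1
  cost-pair {k} {x} {y} xy (d3 , v , yv , tv) ¬tx (w , yw , w≢x , bw) =
    let v≢x = λ { refl → ¬tx tv }
        c , yc , c≢x , c≢v , formula = three-neighbours H y d3 (Adj-sym H xy) yv v≢x
        w≡c = third-neighbour H y {x} {v} {c} formula yw w≢x (λ { refl → two-not-three (proj₁ bw) tv })
    in κ-≤1 (off-three H y (κ (suc (suc k)) y) v≢x c≢x formula)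
         (ℕₚ.m≤n⇒m≤1+n (+-mono-≤ (cost-two yv tv) (cost-bad yc (subst Bad w≡c bw) (two-not-three d3))))

  cost-weak : ∀ {k x y} → Adj H x y → Weak x y → κ (suc (suc (suc k))) x y ≤ 1
  cost-weak {k} {x} {y} xy (d3 , bads) =
    let b , yb , b≢x = another H y d3 (Adj-sym H xy)
        c , yc , c≢x , _ , formula = three-neighbours H y d3 (Adj-sym H xy) yb b≢x
        ¬ty = two-not-three d3
    in κ-≤1 (off-three H y (κ (suc (suc k)) y) b≢x c≢x formula)
         (+-mono-≤ (cost-bad yb (bads b yb b≢x) ¬ty) (cost-bad yc (bads c yc c≢x) ¬ty))

  data GiftView (x y : Fin n) : ℕ → Set where
    toTwo    : Two y → κ 3 x y ≤ 1 → GiftView x y 4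
    toPaired : ¬ Bad x → Bad y → κ 3 x y ≤ 1 → GiftView x y 2
    toBad    : ¬ Bad x → Bad y → κ 3 x y ≤ 2 → GiftView x y 1
    toWeak   : ¬ Two y → κ 3 x y ≤ 1 → GiftView x y 1
    nothing  : GiftView x y 0

  gift-view : ∀ {x y} → Adj H x y → GiftView x y (gift x y)
  gift-view {x} {y} xy with two? y | bad? y | two? x ⊎-dec bad? x | otherBad? x y | weak? x y
  ... | yes t | _ | _ | _ | _ = toTwo t (cost-two xy t)
  ... | no _ | yes b | yes _ | _ | _ = nothing
  ... | no _ | yes b | no ¬tb | yes o | _ = toPaired (¬tb ∘ inj₂) b (cost-pair xy b (¬tb ∘ inj₁) o)
  ... | no _ | yes b | no ¬tb | no _ | _ = toBad (¬tb ∘ inj₂) b (cost-bad xy b (¬tb ∘ inj₁))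
  ... | no ¬t | no _ | _ | _ | yes w = toWeak ¬t (cost-weak xy w)
  ... | no _ | no _ | _ | _ | no _ = nothing

  gift-two : ∀ {x y} → Two y → gift x y ≡ 4
  gift-two {x} {y} t with two? y
  ... | yes _ = refl
  ... | no ¬t = contradiction t ¬t

  gift-bad : ∀ {x y} → Bad y → ¬ Two x → ¬ Bad x → 1 ≤ gift x y
  gift-bad {x} {y} b ¬tx ¬bx with two? y | bad? y | two? x ⊎-dec bad? x | otherBad? x y
  ... | yes _ | _ | _ | _ = s≤s z≤n
  ... | no _ | no ¬b | _ | _ = contradiction b ¬b
  ... | no _ | yes _ | yes (inj₁ tx) | _ = contradiction tx ¬tx
  ... | no _ | yes _ | yes (inj₂ bx) | _ = contradiction bx ¬bx
  ... | no _ | yes _ | no _ | yes _ = s≤s z≤n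
  ... | no _ | yes _ | no _ | no _ = s≤s z≤n

  gift-paired : ∀ {x y} → Bad y → ¬ Two x → ¬ Bad x → OtherBad x y → 2 ≤ gift x y
  gift-paired {x} {y} b ¬tx ¬bx o with two? y | bad? y | two? x ⊎-dec bad? x | otherBad? x y
  ... | yes _ | _ | _ | _ = s≤s (s≤s z≤n)
  ... | no _ | no ¬b | _ | _ = contradiction b ¬b
  ... | no _ | yes _ | yes (inj₁ tx) | _ = contradiction tx ¬tx
  ... | no _ | yes _ | yes (inj₂ bx) | _ = contradiction bx ¬bx
  ... | no _ | yes _ | no _ | yes _ = s≤s (s≤s z≤n)
  ... | no _ | yes _ | no _ | no ¬o = contradiction o ¬o

  gift-weak : ∀ {x y} → ¬ Bad y → Weak x y → 1 ≤ gift x y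
  gift-weak {x} {y} ¬b w with two? y | bad? y | weak? x y
  ... | yes _ | _ | _ = s≤s z≤n
  ... | no _ | yes b | _ = contradiction b ¬b
  ... | no _ | no _ | yes _ = s≤s z≤n
  ... | no _ | no _ | no ¬w = contradiction w ¬w

  gift-cost : ∀ {x y} → Adj H x y → 3 * gift x y + 4 * κ 3 x y ≤ 16
  gift-cost {x} {y} xy with gift x y | gift-view xy
  ... | _ | toTwo _ c      = ℕₚ.+-monoʳ-≤ 12 (ℕₚ.*-monoʳ-≤ 4 c)
  ... | _ | toPaired _ _ c = ≤-trans (ℕₚ.+-monoʳ-≤ 6 (ℕₚ.*-monoʳ-≤ 4 c)) (m≤m+n 10 6)
  ... | _ | toBad _ _ c    = ≤-trans (ℕₚ.+-monoʳ-≤ 3 (ℕₚ.*-monoʳ-≤ 4 c)) (m≤m+n 11 5)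
  ... | _ | toWeak _ c     = ≤-trans (ℕₚ.+-monoʳ-≤ 3 (ℕₚ.*-monoʳ-≤ 4 c)) (m≤m+n 7 9)
  ... | _ | nothing        = ℕₚ.*-monoʳ-≤ 4 (κ≤4 3 x y)

  gift-≤4 : ∀ {x y} → Adj H x y → gift x y ≤ 4
  gift-≤4 {x} {y} xy with gift x y | gift-view xy
  ... | _ | toTwo _ _      = ≤-refl
  ... | _ | toPaired _ _ _ = s≤s (s≤s z≤n)
  ... | _ | toBad _ _ _    = s≤s z≤n
  ... | _ | toWeak _ _     = s≤s z≤n
  ... | _ | nothing        = z≤n

  gift-zero : ∀ {x y} → Adj H x y → 3 ≤ κ 3 x y → gift x y ≡ 0
  gift-zero {x} {y} xy h with gift x y | gift-view xy
  ... | _ | toTwo _ c      = contradiction (≤-trans h c) λ { (s≤s ()) }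
  ... | _ | toPaired _ _ c = contradiction (≤-trans h c) λ { (s≤s ()) }
  ... | _ | toBad _ _ c    = contradiction (≤-trans h c) λ { (s≤s (s≤s ())) }
  ... | _ | toWeak _ c     = contradiction (≤-trans h c) λ { (s≤s ()) }
  ... | _ | nothing        = refl

  module _ (irreducible : ∀ r → Positive H r → 7 ≤ neighbourSum H r (κ 3 r)) where

    private
      c₃ = κ 3

    Discharged : Fin n → Set
    Discharged u = 28 + neighbourSum H u (gift u) ≤ 10 * degree H u + neighbourSum H u (λ w → gift w u)

    discharge-≥4 : ∀ u → 4 ≤ degree H u → Discharged u
    discharge-≥4 u d≥4 = charge-≥4 linear (irreducible u (≤-trans (s≤s z≤n) d≥4)) d≥4
      where
      linear : 3 * neighbourSum H u (gift u) + 4 * neighbourSum H u (c₃ u) ≤ 16 * degree H u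
      linear = begin
        3 * neighbourSum H u (gift u) + 4 * neighbourSum H u (c₃ u)                 ≡⟨ cong₂ _+_ (neighbourSum-* H u 3 (gift u)) (neighbourSum-* H u 4 (c₃ u)) ⟩
        neighbourSum H u (λ w → 3 * gift u w) + neighbourSum H u (λ w → 4 * c₃ u w) ≡⟨ sym (neighbourSum-+ H u (λ w → 3 * gift u w) (λ w → 4 * c₃ u w)) ⟩
        neighbourSum H u (λ w → 3 * gift u w + 4 * c₃ u w)                          ≤⟨ neighbourSum-bound H u 16 (λ w → gift-cost) ⟩
        16 * degree H u                                                             ∎
        where open ℕₚ.≤-Reasoning

    discharge-1 : ∀ u → degree H u ≢ 1
    discharge-1 u eq = contradiction (≤-trans (irreducible u (≤-reflexive (sym eq)))
      (subst (λ d → neighbourSum H u (c₃ u) ≤ 4 * d) eq (neighbourSum-bound H u 4 λ w _ → κ≤4 3 u w)))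
      λ { (s≤s (s≤s (s≤s (s≤s ())))) }

    -- Either neighbour costs at least 7 - 4 = 3, and neighbours that expensive receive no gift,
    -- while both pay 4 to `u`.
    discharge-2 : ∀ u → degree H u ≡ 2 → Discharged u
    discharge-2 u d2 =
      let a , ua = neighbour H u (≤-trans (s≤s z≤n) (≤-reflexive (sym d2)))
          b , ub , _ , formula = two-neighbours H u d2 ua
          costs = subst (7 ≤_) (formula (c₃ u)) (irreducible u (≤-trans (s≤s z≤n) (≤-reflexive (sym d2))))
      in charge-2 d2
        (trans (formula (gift u))
          (cong₂ _+_ (gift-zero ua (rest-≥3 costs (κ≤4 3 u b))) (gift-zero ub (rest-of (κ≤4 3 u a) costs))))
        (trans (formula (λ w → gift w u)) (cong₂ _+_ (gift-two d2) (gift-two d2)))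

    -- The neighbour `v` of degree 2 costs at most 1, so `b` and `c` together cost at least 6 and
    -- each at least 2: neither has degree 2, and `u` gives to `v` alone. If both were bad they
    -- would cost only 2 + 2, and those that are not bad supply the missing 2.
    discharge-bad : ∀ u → Bad u → Discharged u
    discharge-bad u bu@(d3 , v , uv , tv) = charge-3 d3 (formula (gift u)) (formula (λ w → gift w u))
      (gifts (bad? b) (bad? c))
      where
      b-data = another H u d3 uv
      b = proj₁ b-data
      ub = proj₁ (proj₂ b-data)
      b≢v = proj₂ (proj₂ b-data)
      c-data = three-neighbours H u d3 uv ub b≢v
      c = proj₁ c-data
      uc = proj₁ (proj₂ c-data)
      c≢b = proj₁ (proj₂ (proj₂ (proj₂ c-data)))
      formula = proj₂ (proj₂ (proj₂ (proj₂ c-data)))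
      ¬tu : ¬ Two u
      ¬tu = two-not-three d3
      costs : 7 ≤ c₃ u v + (c₃ u b + c₃ u c)
      costs = subst (7 ≤_) (formula (c₃ u)) (irreducible u (≤-trans (s≤s z≤n) (≤-reflexive (sym d3))))
      6≤ : 6 ≤ c₃ u b + c₃ u c
      6≤ = rest-of {1} (cost-two uv tv) costs
      cb≥2 : 2 ≤ c₃ u b
      cb≥2 = rest-of {4} (κ≤4 3 u c) (subst (6 ≤_) (ℕₚ.+-comm (c₃ u b) (c₃ u c)) 6≤)
      cc≥2 : 2 ≤ c₃ u c
      cc≥2 = rest-of {4} (κ≤4 3 u b) 6≤
      no-gift : ∀ {w} → Adj H u w → 2 ≤ c₃ u w → gift u w ≡ 0
      no-gift {w} uw h with gift u w | gift-view uw
      ... | _ | toTwo _ l        = contradiction (≤-trans h l) λ { (s≤s ()) }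
      ... | _ | toPaired ¬bu _ _ = contradiction bu ¬bu
      ... | _ | toBad ¬bu _ _    = contradiction bu ¬bu
      ... | _ | toWeak _ l       = contradiction (≤-trans h l) λ { (s≤s ()) }
      ... | _ | nothing          = refl
      not-two : ∀ {w} → Adj H u w → 2 ≤ c₃ u w → ¬ Two w
      not-two uw h tw = contradiction (≤-trans h (cost-two uw tw)) λ { (s≤s ()) }
      gifts : Dec (Bad b) → Dec (Bad c) →
        gift u v + (gift u b + gift u c) ≤ 2 + (gift v u + (gift b u + gift c u))
      gifts bb bc = begin
        gift u v + (gift u b + gift u c)       ≡⟨ cong₂ _+_ (gift-two tv) (cong₂ _+_ (no-gift ub cb≥2) (no-gift uc cc≥2)) ⟩
        4                                      ≤⟨ ℕₚ.+-monoʳ-≤ 2 (≤-trans (received bb bc) (ℕₚ.m≤n+m _ (gift v u))) ⟩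
        2 + (gift v u + (gift b u + gift c u)) ∎
        where
        open ℕₚ.≤-Reasoning
        received : Dec (Bad b) → Dec (Bad c) → 2 ≤ gift b u + gift c u
        received (yes bb) (yes bc) = contradiction
          (≤-trans 6≤ (+-mono-≤ (cost-bad ub bb ¬tu) (cost-bad uc bc ¬tu))) λ { (s≤s (s≤s (s≤s (s≤s ())))) }
        received (yes bb) (no ¬bc) = ≤-trans
          (gift-paired bu (not-two uc cc≥2) ¬bc (b , ub , c≢b ∘ sym , bb)) (ℕₚ.m≤n+m _ (gift b u))
        received (no ¬bb) (yes bc) = ≤-trans
          (gift-paired bu (not-two ub cb≥2) ¬bb (c , uc , c≢b , bc)) (m≤m+n _ (gift c u))
        received (no ¬bb) (no ¬bc) = +-mono-≤
          (gift-bad bu (not-two ub cb≥2) ¬bb) (gift-bad bu (not-two uc cc≥2) ¬bc)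

    -- Recipients of gifts cost at most 2 each, so three of them would stay below 7: some neighbour
    -- receives nothing, and by symmetry it may be listed first.
    discharge-good : ∀ u → degree H u ≡ 3 → ¬ Bad u → Discharged u
    discharge-good u d3 ¬bu =
      let a , ua = neighbour H u (≤-trans (s≤s z≤n) (≤-reflexive (sym d3)))
          b , ub , b≢a = another H u d3 ua
          c , uc , c≢a , _ , formula = three-neighbours H u d3 ua ub b≢a
      in three ua ub uc b≢a c≢a formula
      where
      not-two : ∀ {w} → Adj H u w → ¬ Two w
      not-two uw tw = ¬bu (d3 , _ , uw , tw)

      low : ∀ {w g} → GiftView u w g → 1 ≤ g → c₃ u w ≤ 2
      low (toTwo _ l) _ = ℕₚ.m≤n⇒m≤1+n l
      low (toPaired _ _ l) _ = ℕₚ.m≤n⇒m≤1+n l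
      low (toBad _ _ l) _ = l
      low (toWeak _ l) _ = ℕₚ.m≤n⇒m≤1+n l

      module ZeroFirst {a b c : Fin n} (ua : Adj H u a) (ub : Adj H u b) (uc : Adj H u c)
                       (b≢a : b ≢ a) (formula : ∀ f → neighbourSum H u f ≡ f a + (f b + f c))
                       (costs : 7 ≤ c₃ u a + (c₃ u b + c₃ u c)) where

        3≤ : 3 ≤ c₃ u b + c₃ u c
        3≤ = rest-of {4} (κ≤4 3 u a) costs

        bads : Bad b → Bad c → 1 ≤ gift a u
        bads bb bc = gift-weak ¬bu (d3 , each)
          where
          each : ∀ w → Adj H u w → w ≢ a → Bad w
          each w uw w≢a with w ≟ b
          ... | yes refl = bb
          ... | no w≢b = subst Bad (sym (third-neighbour H u {a} {b} {c} formula uw w≢a w≢b)) bc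

        -- These two neighbours cost at least 3 together, so a gift of 2 occurs neither twice nor
        -- beside a gift to a weak vertex. A total of 3 remains only when both are bad; then `u` is
        -- weak towards `a` and gets 1 back.
        pair : ∀ {g h} → GiftView u b g → GiftView u c h → g + h ≤ 2 + gift a u
        pair (toTwo t _)      _                = contradiction t (not-two ub)
        pair (toPaired _ _ _) (toTwo t _)      = contradiction t (not-two uc)
        pair (toBad _ _ _)    (toTwo t _)      = contradiction t (not-two uc)
        pair (toWeak _ _)     (toTwo t _)      = contradiction t (not-two uc)
        pair nothing          (toTwo t _)      = contradiction t (not-two uc)
        pair (toPaired _ _ l) (toPaired _ _ m) = contradiction (≤-trans 3≤ (+-mono-≤ l m)) λ { (s≤s (s≤s ())) }
        pair (toPaired _ _ l) (toWeak _ m)     = contradiction (≤-trans 3≤ (+-mono-≤ l m)) λ { (s≤s (s≤s ())) }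
        pair (toWeak _ l)     (toPaired _ _ m) = contradiction (≤-trans 3≤ (+-mono-≤ l m)) λ { (s≤s (s≤s ())) }
        pair (toPaired _ x _) (toBad _ y _)    = ℕₚ.+-monoʳ-≤ 2 (bads x y)
        pair (toBad _ x _)    (toPaired _ y _) = ℕₚ.+-monoʳ-≤ 2 (bads x y)
        pair (toPaired _ _ _) nothing          = m≤m+n 2 _
        pair (toBad _ _ _)    (toBad _ _ _)    = m≤m+n 2 _
        pair (toBad _ _ _)    (toWeak _ _)     = m≤m+n 2 _
        pair (toBad _ _ _)    nothing          = s≤s z≤n
        pair (toWeak _ _)     (toBad _ _ _)    = m≤m+n 2 _
        pair (toWeak _ _)     (toWeak _ _)     = m≤m+n 2 _
        pair (toWeak _ _)     nothing          = s≤s z≤n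
        pair nothing          (toPaired _ _ _) = m≤m+n 2 _
        pair nothing          (toBad _ _ _)    = s≤s z≤n
        pair nothing          (toWeak _ _)     = s≤s z≤n
        pair nothing          nothing          = z≤n

        discharged : gift u a ≡ 0 → Discharged u
        discharged z = charge-3 d3 (formula (gift u)) (formula (λ w → gift w u))
          (≤-trans (subst (λ g → g + (gift u b + gift u c) ≤ 2 + gift a u) (sym z) (pair (gift-view ub) (gift-view uc)))
            (ℕₚ.+-monoʳ-≤ 2 (m≤m+n (gift a u) _)))

      three : ∀ {a b c} → Adj H u a → Adj H u b → Adj H u c → b ≢ a → c ≢ a →
              (∀ f → neighbourSum H u f ≡ f a + (f b + f c)) → Discharged u
      three {a} {b} {c} ua ub uc b≢a c≢a formula = some-zero (gift-view ua) (gift-view ub) (gift-view uc) refl refl refl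
        where
        costs : 7 ≤ c₃ u a + (c₃ u b + c₃ u c)
        costs = subst (7 ≤_) (formula (c₃ u)) (irreducible u (≤-trans (s≤s z≤n) (≤-reflexive (sym d3))))
        some-zero : ∀ {x y z} → GiftView u a x → GiftView u b y → GiftView u c z →
                    gift u a ≡ x → gift u b ≡ y → gift u c ≡ z → Discharged u
        some-zero {zero} _ _ _ ea _ _ = ZeroFirst.discharged ua ub uc b≢a formula costs ea
        some-zero {suc _} {zero} _ _ _ _ eb _ = ZeroFirst.discharged ub ua uc (b≢a ∘ sym)
          (λ f → trans (formula f) (x∙yz≈y∙xz (f a) (f b) (f c)))
          (subst (7 ≤_) (x∙yz≈y∙xz (c₃ u a) (c₃ u b) (c₃ u c)) costs) eb
        some-zero {suc _} {suc _} {zero} _ _ _ _ _ ec = ZeroFirst.discharged uc ua ub (c≢a ∘ sym)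
          (λ f → trans (formula f) (x∙yz≈z∙xy (f a) (f b) (f c)))
          (subst (7 ≤_) (x∙yz≈z∙xy (c₃ u a) (c₃ u b) (c₃ u c)) costs) ec
        some-zero {suc _} {suc _} {suc _} va vb vc _ _ _ = contradiction
          (≤-trans costs (+-mono-≤ (low va (s≤s z≤n)) (+-mono-≤ (low vb (s≤s z≤n)) (low vc (s≤s z≤n)))))
          λ { (s≤s (s≤s (s≤s (s≤s (s≤s (s≤s ())))))) }

    discharge : ∀ u → Positive H u → Discharged u
    discharge u d≥1 = by-degree (degree H u) refl
      where
      by-degree : ∀ d → degree H u ≡ d → Discharged u
      by-degree 0 eq = contradiction (subst (1 ≤_) eq d≥1) λ ()
      by-degree 1 eq = contradiction eq (discharge-1 u)
      by-degree 2 eq = discharge-2 u eq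
      by-degree 3 eq = by-badness (bad? u)
        where
        by-badness : Dec (Bad u) → Discharged u
        by-badness (yes b) = discharge-bad u b
        by-badness (no ¬b) = discharge-good u eq ¬b
      by-degree (suc (suc (suc (suc d)))) eq = discharge-≥4 u (subst (4 ≤_) (sym eq) (s≤s (s≤s (s≤s (s≤s z≤n)))))

    private
      gifts-balance : sum (λ u → neighbourSum H u (gift u)) ≡ sum (λ u → neighbourSum H u (λ w → gift w u))
      gifts-balance = trans (∑-comm λ u w → when (adj? H u w) (gift u w))
        (sum-cong-≗ λ w → sum-cong-≗ λ u → cong (λ b → if b then gift u w else 0) (Graph.symmetric H u w))

    discharging : 28 * count (positive? H) ≤ 10 * sum (degree H)
    discharging = ℕₚ.+-cancelʳ-≤ (sum λ u → neighbourSum H u (gift u)) _ _ (begin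
      28 * count (positive? H) + sum (λ u → neighbourSum H u (gift u))
        ≡⟨ cong (_+ sum (λ u → neighbourSum H u (gift u))) (trans (*-distribˡ-sum 28 (λ u → when (positive? H u) 1)) (sum-cong-≗ λ u → when-* (positive? H u) 28 1)) ⟩
      sum (λ u → when (positive? H u) 28) + sum (λ u → neighbourSum H u (gift u))
        ≡⟨ sym (∑-distrib-+ (λ u → when (positive? H u) 28) (λ u → neighbourSum H u (gift u))) ⟩
      sum (λ u → when (positive? H u) 28 + neighbourSum H u (gift u))
        ≤⟨ sum-mono local ⟩
      sum (λ u → 10 * degree H u + neighbourSum H u (λ w → gift w u))
        ≡⟨ ∑-distrib-+ (λ u → 10 * degree H u) (λ u → neighbourSum H u (λ w → gift w u)) ⟩
      sum (λ u → 10 * degree H u) + sum (λ u → neighbourSum H u (λ w → gift w u))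
        ≡⟨ cong₂ _+_ (sym (*-distribˡ-sum 10 (degree H))) (sym gifts-balance) ⟩
      10 * sum (degree H) + sum (λ u → neighbourSum H u (gift u)) ∎)
      where
      open ℕₚ.≤-Reasoning
      local : ∀ u → when (positive? H u) 28 + neighbourSum H u (gift u) ≤ 10 * degree H u + neighbourSum H u (λ w → gift w u)
      local u = by-sign (positive? H u)
        where
        by-sign : (d : Dec (Positive H u)) →
                  when d 28 + neighbourSum H u (gift u) ≤ 10 * degree H u + neighbourSum H u (λ w → gift w u)
        by-sign (yes d≥1) = discharge u d≥1
        -- Without the constant 28, the crude bound of 4 per gift is enough.
        by-sign (no d≱1) = ≤-trans (neighbourSum-bound H u 4 (λ w → gift-≤4))
          (≤-trans (ℕₚ.*-monoˡ-≤ (degree H u) {4} {10} (s≤s (s≤s (s≤s (s≤s z≤n))))) (m≤m+n _ _))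

-- Minimal uncolourable subgraphs

_⊆ᴳ_ : ∀ {n} → Graph n → Graph n → Set
H ⊆ᴳ G = ∀ {u v} → Adj H u v → Adj G u v

sum-mono-< : ∀ {n} {f g : Fin n → ℕ} a → (∀ i → f i ≤ g i) → f a < g a → sum f < sum g
sum-mono-< {f = f} {g} a h lt = subst₂ _<_ (sym (sum-off a f)) (sym (sum-off a g))
  (ℕₚ.+-mono-<-≤ lt (sum-mono λ i → when-mono (¬? (i ≟ a)) (¬? (i ≟ a)) id λ _ → h i))

T-does⁺ : {P : Set} (d : Dec P) → P → T (does d)
T-does⁺ (yes _) _ = _
T-does⁺ (no ¬p) p = ¬p p

T-does⁻ : {P : Set} (d : Dec P) → T (does d) → P
T-does⁻ (yes p) _ = p

module _ {n : ℕ} (H : Graph n) (r : Fin n) where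

  private
    keep? : ∀ u v → Dec (Adj H u v × u ≢ r × v ≢ r)
    keep? u v = adj? H u v ×-dec ¬? (u ≟ r) ×-dec ¬? (v ≟ r)

  -- Only the edges at `r` are deleted, so that all subgraphs share one vertex set and colourings
  -- need no translation.
  isolate : Graph n
  isolate = record
    { adjacent    = λ u v → does (keep? u v)
    ; symmetric   = λ u v → does-⇔ (flip u v) (flip v u)
    ; irreflexive = λ v → dec-false (keep? v v) (adj-irrefl H ∘ proj₁)
    }
    where
    flip : ∀ u v → Adj H u v × u ≢ r × v ≢ r → Adj H v u × v ≢ r × u ≢ r
    flip u v (a , x , y) = Adj-sym H a , y , x
    does-⇔ : ∀ {u v} → (Adj H u v × u ≢ r × v ≢ r → Adj H v u × v ≢ r × u ≢ r) →
             (Adj H v u × v ≢ r × u ≢ r → Adj H u v × u ≢ r × v ≢ r) → does (keep? u v) ≡ does (keep? v u)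
    does-⇔ {u} {v} to from = does-≡ (map′ to from (keep? u v)) (keep? v u)

  isolate-to : ∀ {u v} → Adj H u v → u ≢ r → v ≢ r → Adj isolate u v
  isolate-to {u} {v} a x y = T-does⁺ (keep? u v) (a , x , y)

  isolate-from : ∀ {u v} → Adj isolate u v → Adj H u v × u ≢ r × v ≢ r
  isolate-from {u} {v} = T-does⁻ (keep? u v)

  isolate-smaller : Positive H r → sum (degree isolate) < sum (degree H)
  isolate-smaller pos = sum-mono-< r
    (λ u → count-mono (adj? isolate u) (adj? H u) λ v a → proj₁ (isolate-from a))
    (subst (_< degree H r) (sym (sum-zero λ v → when-no (adj? isolate r v) λ a → proj₁ (proj₂ (isolate-from a)) refl)) pos)

subgraph-cycle : ∀ {n} {H G : Graph n} → H ⊆ᴳ G → ∀ {k} → Cycle H k → Cycle G k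
subgraph-cycle sub C = record
  { long = long ; vertex = vertex ; injective = injective ; step = sub ∘ step ; close = sub close }
  where open Cycle C

module _ {n : ℕ} (G : Graph n) (long : LongCycles G)
  (euler-bound : ∀ H → H ⊆ᴳ G → (∀ u → Positive H u → 2 ≤ degree H u) →
     ∃₂ (Adj H) → 5 * sum (degree H) + 28 ≤ 14 * count (positive? H))
  (π : Fin n → Fin n → 𝔽₂) (π-sym : ∀ u v → π u v ≡ π v u) where

  module Minimal (H : Graph n) (sub : H ⊆ᴳ G)
    (smaller : ∀ H′ → H′ ⊆ᴳ G → sum (degree H′) < sum (degree H) → ¬ ¬ ∃ (Proper H′ π))
    (uncolourable : ¬ ∃ (Proper H π)) where

    longH : LongCycles H
    longH = long ∘ subgraph-cycle sub

    -- If the costs at `r` were at most 6, a colouring of `H` without the edges at `r` would extend.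
    -- The goal is decidable, so a colouring up to double negation suffices.
    irreducible : ∀ {k} → Separated H longH k → ∀ r → Positive H r → 7 ≤ neighbourSum H r (cost H k r)
    irreducible {k} sep r pos = ℕₚ.≰⇒> λ few →
      smaller (isolate H r) (sub ∘ proj₁ ∘ isolate-from H r) (isolate-smaller H r pos) λ (c , proper) →
        uncolourable (tree-extension H longH π π-sym c sep
          (λ u v a x y → proper u v (isolate-to H r a x y)) few)

    adjacent-positive : ∀ {u v} → Adj H u v → Positive H u
    adjacent-positive {u} a = neighbourSum-≥ H u (λ _ → 1) a

    off-four : ∀ {u v} → Adj H u v → degree H u ≤ 2 → neighbourSum H u (off v λ _ → 4) ≤ 4
    off-four {u} {v} a d≤2 = begin
      neighbourSum H u (off v λ _ → 4)             ≡⟨ sum-cong-≗ (λ w → when-cong (adj? H u w) λ _ → sym (when-* (¬? (w ≟ v)) 4 1)) ⟩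
      neighbourSum H u (λ w → 4 * off v (λ _ → 1) w) ≡⟨ sym (neighbourSum-* H u 4 (off v λ _ → 1)) ⟩
      4 * neighbourSum H u (off v λ _ → 1)         ≤⟨ ℕₚ.*-monoʳ-≤ 4 (ℕₚ.≤-pred (subst (_≤ 2) (degree-split H a (λ _ → 1)) d≤2)) ⟩
      4                                            ∎
      where open ℕₚ.≤-Reasoning

    -- Depth 1 rests on the girth alone and yields the fact about vertices of degree 2 on which
    -- depth 3 depends.
    separated₁ : Separated H longH 1
    separated₁ = s≤s z≤n , λ ()

    -- At `s`, the neighbour `t` costs 1 and at most one other neighbour costs up to 4, which stays
    -- below 7.
    two-vertices-nonadjacent : ∀ {s t} → Adj H s t → degree H s ≤ 2 → ¬ degree H t ≤ 2
    two-vertices-nonadjacent {s} {t} a ds dt = contradiction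
      (≤-trans (irreducible {1} separated₁ s (adjacent-positive a)) (begin
        neighbourSum H s (cost H 1 s)                          ≡⟨ degree-split H a (cost H 1 s) ⟩
        cost H 1 s t + neighbourSum H s (off t (cost H 1 s))   ≤⟨ +-mono-≤ (≤-reflexive (price-1 (off-four (Adj-sym H a) dt))) rest ⟩
        1 + 4                                                  ∎))
      λ { (s≤s (s≤s (s≤s (s≤s (s≤s ()))))) }
      where
      open ℕₚ.≤-Reasoning
      rest : neighbourSum H s (off t (cost H 1 s)) ≤ 4
      rest = ≤-trans (neighbourSum-mono H s λ w _ → when-mono (¬? (w ≟ t)) (¬? (w ≟ t)) id λ _ → cost-≤4 H 1 s w)
        (off-four a ds)

    separated₃ : Separated H longH 3
    separated₃ = ≤-refl , λ _ → two-vertices-nonadjacent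

    minimum-degree : ∀ u → Positive H u → 2 ≤ degree H u
    minimum-degree u pos = ℕₚ.*-cancelˡ-< 4 1 (degree H u) (ℕₚ.≤-trans (m≤m+n 5 2)
      (≤-trans (irreducible {3} separated₃ u pos) (neighbourSum-bound H u 4 λ w _ → cost-≤4 H 3 u w)))

    -- An edgeless graph is coloured by a constant. The edge provides the component behind the 28 in
    -- Euler's bound.
    some-edge : ∃₂ (Adj H)
    some-edge with any? (λ u → any? λ v → adj? H u v)
    ... | yes e = e
    ... | no none = contradiction ((λ _ → zero) , λ u v a → contradiction (u , v , a) none) uncolourable

    absurd : ⊥
    absurd = clash (sum (degree H)) (count (positive? H))
      (euler-bound H sub minimum-degree some-edge)
      (discharging H (cost H) (cost-≤4 H) (λ _ _ _ → refl) (irreducible {3} separated₃))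
      where
      clash : ∀ h p → 5 * h + 28 ≤ 14 * p → 28 * p ≤ 10 * h → ⊥
      clash h p e d = contradiction (farkas 56 0 0 (+-mono-≤ (ℕₚ.*-monoʳ-≤ 2 e) d) (identity h p)) λ ()
        where
        identity : ∀ h p → 56 + (2 * (14 * p) + 10 * h) + 0 ≡ 0 + (2 * (5 * h + 28) + 28 * p)
        identity = solve-∀

  -- Minimality takes the form of strong induction on the degree sum, double-negated; the negations
  -- are removed once, at the very end, because colourability is decidable.
  ¬¬colourable : ∀ H → H ⊆ᴳ G → ¬ ¬ ∃ (Proper H π)
  ¬¬colourable H sub = <-rec (λ e → ∀ H → H ⊆ᴳ G → sum (degree H) ≡ e → ¬ ¬ ∃ (Proper H π))
    (λ { e ih H sub refl un → Minimal.absurd H sub (λ H′ sub′ lt → ih lt H′ sub′ refl) un }) _ H sub refl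

-- Decidability of colourability

search : ∀ m {n} {P : Vec (Fin n) m → Set} → (∀ xs → Dec (P xs)) → Dec (∃ P)
search zero P? = map′ ([] ,_) (λ { ([] , p) → p }) (P? [])
search (suc m) P? = map′ (λ (x , xs , p) → x ∷ xs , p) (λ { (x ∷ xs , p) → x , xs , p })
  (any? λ x → search m λ xs → P? (x ∷ xs))

colourable? : ∀ {n} (H : Graph n) π → Dec (∃ (Proper H π))
colourable? {n} H π = map′ (λ (xs , p) → lookup xs , p)
  (λ (c , p) → tabulate c , λ u v a → subst₂ (λ x y → dot x y ≡ π u v)
    (sym (lookup∘tabulate c u)) (sym (lookup∘tabulate c v)) (p u v a))
  (search n λ xs → all? λ u → all? λ v → adj? H u v →-dec (dot (lookup xs u) (lookup xs v) ℙₚ.≟ π u v))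

-- Partitions, permutations and genus

count-injection : ∀ {m k} {P : Fin m → Set} {Q : Fin k → Set}
  (P? : ∀ x → Dec (P x)) (Q? : ∀ y → Dec (Q y)) (f : Fin m → Fin k) →
  (∀ x → P x → Q (f x)) → (∀ x y → P x → P y → f x ≡ f y → x ≡ y) → count P? ≤ count Q?
count-injection {m} {k} {P} {Q} P? Q? f f-Q f-inj = begin
  count P?                                              ≡⟨ sum-cong-≗ (λ x → sym (trans (sum-single (hit x) (f x) (miss x)) (when-yes (f x ≟ f x) refl))) ⟩
  sum (λ x → sum (hit x))                               ≡⟨ ∑-comm hit ⟩
  sum (λ y → sum (λ x → hit x y))                       ≤⟨ sum-mono column ⟩
  count Q?                                              ∎
  where
  open ℕₚ.≤-Reasoning
  hit : Fin m → Fin k → ℕ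
  hit x y = when (f x ≟ y) (when (P? x) 1)
  miss : ∀ x y → y ≢ f x → hit x y ≡ 0
  miss x y ne = when-no (f x ≟ y) (ne ∘ sym)
  hit-view : ∀ {x y} → 1 ≤ hit x y → f x ≡ y × P x
  hit-view {x} {y} h = eq , when-positive (P? x) (subst (1 ≤_) (when-yes (f x ≟ y) eq) h)
    where eq = when-positive (f x ≟ y) h
  at-most-one : ∀ y → sum (λ x → hit x y) ≤ 1
  at-most-one y = sum-atMostOne (λ x → hit x y)
    (λ x → when-≤ (f x ≟ y) λ _ → when-≤ (P? x) λ _ → ≤-refl)
    λ x x′ h h′ → let eq , Px = hit-view h
                      eq′ , Px′ = hit-view h′
                  in f-inj x x′ Px Px′ (trans eq (sym eq′))
  column : ∀ y → sum (λ x → hit x y) ≤ when (Q? y) 1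
  column y = by-Q (Q? y)
    where
    by-Q : (d : Dec (Q y)) → sum (λ x → hit x y) ≤ when d 1
    by-Q (yes _) = at-most-one y
    by-Q (no ¬q) = ≤-reflexive (sum-zero λ x → ℕₚ.n<1⇒n≡0 (ℕₚ.≰⇒> λ h →
      let eq , Px = hit-view h in ¬q (subst Q eq (f-Q x Px))))

count-all : ∀ m → count {m} (λ _ → yes tt) ≡ m
count-all m = trans (sum-const m 1) (ℕₚ.*-identityʳ m)

count-split : ∀ {m} {P Q : Fin m → Set} (P? : ∀ x → Dec (P x)) (Q? : ∀ x → Dec (Q x)) →
  count P? ≡ count (λ x → P? x ×-dec Q? x) + count (λ x → P? x ×-dec ¬? (Q? x))
count-split P? Q? = trans (sum-cong-≗ split)
  (∑-distrib-+ (λ x → when (P? x ×-dec Q? x) 1) (λ x → when (P? x ×-dec ¬? (Q? x)) 1))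
  where
  split : ∀ x → when (P? x) 1 ≡ when (P? x ×-dec Q? x) 1 + when (P? x ×-dec ¬? (Q? x)) 1
  split x with P? x | Q? x
  ... | yes _ | yes _ = refl
  ... | yes _ | no _  = refl
  ... | no _  | yes _ = refl
  ... | no _  | no _  = refl

count-positive : ∀ {m} {P : Fin m → Set} (P? : ∀ x → Dec (P x)) {a} → P a → 1 ≤ count P?
count-positive P? {a} Pa = subst (_≤ count P?) (when-yes (P? a) Pa) (sum-≥ (λ x → when (P? x) 1) a)

count-without-< : ∀ {m} {P : Fin m → Set} (P? : ∀ x → Dec (P x)) {a} → P a →
                  count (λ x → P? x ×-dec ¬? (x ≟ a)) < count P?
count-without-< P? {a} Pa = subst (count (λ x → P? x ×-dec ¬? (x ≟ a)) <_)
  (sym (count-split P? (_≟ a)))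
  (ℕₚ.+-monoˡ-≤ (count (λ x → P? x ×-dec ¬? (x ≟ a)))
    (count-positive (λ x → P? x ×-dec (x ≟ a)) (Pa , refl)))

-- Fed to `finest`, this relation turns a property that every generating step preserves and reflects
-- into an invariant of the classes.
iff-equivalence : ∀ {A : Set} (Z : A → Set) → IsEquivalence {A = A} (λ x y → (Z x → Z y) × (Z y → Z x))
iff-equivalence Z = record
  { refl = id , id
  ; sym = λ (f , g) → g , f
  ; trans = λ (f , g) (f′ , g′) → f′ ∘ f , g ∘ g′ }

-- An idempotent choice of representatives makes relatedness decidable and the number of classes a
-- count of fixed points.
record Partition (m : ℕ) : Set where
  field
    rep  : Fin m → Fin m
    idem : ∀ x → rep (rep x) ≡ rep x

  _∼_ : Rel (Fin m) 0ℓ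
  x ∼ y = rep x ≡ rep y

  _∼?_ : ∀ x y → Dec (x ∼ y)
  x ∼? y = rep x ≟ rep y

  ∼-equivalence : IsEquivalence _∼_
  ∼-equivalence = record { refl = refl ; sym = sym ; trans = trans }

  Representative : Fin m → Set
  Representative x = rep x ≡ x

  representative? : ∀ x → Dec (Representative x)
  representative? x = rep x ≟ x

  size : ℕ
  size = count representative?

  representative-unique : ∀ {x y} → Representative x → Representative y → x ∼ y → x ≡ y
  representative-unique p q e = trans (sym p) (trans e q)

open Partition using (rep; idem; size; Representative; representative?; representative-unique; ∼-equivalence)

related : ∀ {m} → Partition m → Rel (Fin m) 0ℓ
related = Partition._∼_

record IsClosure {m} (P : Partition m) (S : Rel (Fin m) 0ℓ) : Set₁ where
  field
    generated : S ⇒ related P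
    finest    : ∀ {Q : Rel (Fin m) 0ℓ} → IsEquivalence Q → S ⇒ Q → related P ⇒ Q

open IsClosure

size-mono : ∀ {m} (P Q : Partition m) → related P ⇒ related Q → size Q ≤ size P
size-mono P Q P⇒Q = count-injection (representative? Q) (representative? P) (rep P)
  (λ x _ → idem P x) (λ x y p q e → representative-unique Q p q (P⇒Q e))

discrete : ∀ {m} → Partition m
discrete = record { rep = id ; idem = λ _ → refl }

discrete-closure : ∀ {m} → IsClosure (discrete {m}) (λ _ _ → ⊥)
discrete-closure = record
  { generated = λ () ; finest = λ eqv _ x≡y → IsEquivalence.reflexive eqv x≡y }

module _ {m : ℕ} (P : Partition m) (a b : Fin m) where

  private
    redirect : ∀ {x} → Dec (related P x b) → Fin m
    redirect {x} (yes _) = rep P a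
    redirect {x} (no _)  = rep P x

    merged : Fin m → Fin m
    merged x = redirect {x} (Partition._∼?_ P x b)

    merged-cong : ∀ {x y} → related P x y → merged x ≡ merged y
    merged-cong {x} {y} e with Partition._∼?_ P x b | Partition._∼?_ P y b
    ... | yes _ | yes _ = refl
    ... | yes p | no q  = contradiction (trans (sym e) p) q
    ... | no p  | yes q = contradiction (trans e q) p
    ... | no _  | no _  = e

    merged-a : merged a ≡ rep P a
    merged-a with Partition._∼?_ P a b
    ... | yes _ = refl
    ... | no _  = refl

    merged-b : merged b ≡ rep P a
    merged-b with Partition._∼?_ P b b
    ... | yes _ = refl
    ... | no ne = contradiction refl ne

    merged-idem : ∀ x → merged (merged x) ≡ merged x
    merged-idem x with Partition._∼?_ P x b
    ... | yes _ = trans (merged-cong (idem P a)) merged-a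
    ... | no ne with Partition._∼?_ P (rep P x) b
    ...   | yes p = contradiction (trans (sym (idem P x)) p) ne
    ...   | no _  = idem P x

  merge : Partition m
  merge = record { rep = merged ; idem = merged-idem }

  merge-coarser : related P ⇒ related merge
  merge-coarser {x} {y} = merged-cong {x} {y}

  merge-joins : related merge a b
  merge-joins = trans merged-a (sym merged-b)

  merge-closure : ∀ {S} → IsClosure P S →
                  IsClosure merge (λ x y → S x y ⊎ (x ≡ a × y ≡ b))
  merge-closure {S} cl = record
    { generated = λ { {x} {y} (inj₁ s) → merge-coarser {x} {y} (generated cl s) ; (inj₂ (refl , refl)) → merge-joins }
    ; finest = fin
    }
    where
    fin : ∀ {Q : Rel (Fin m) 0ℓ} → IsEquivalence Q → (λ x y → S x y ⊎ (x ≡ a × y ≡ b)) ⇒ Q → related merge ⇒ Q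
    fin {Q} eqv S⇒Q {x} {y} e = E.trans (toMerged x) (subst (λ z → Q z y) (sym e) (E.sym (toMerged y)))
      where
      module E = IsEquivalence eqv
      P⇒Q : related P ⇒ Q
      P⇒Q = finest cl eqv (S⇒Q ∘ inj₁)
      toMerged : ∀ x → Q x (merged x)
      toMerged x with Partition._∼?_ P x b
      ... | yes p = E.trans (P⇒Q p) (E.trans (E.sym (S⇒Q (inj₂ (refl , refl)))) (P⇒Q (sym (idem P a))))
      ... | no _  = P⇒Q (sym (idem P x))

  size-merge-≤ : size P ≤ suc (size merge)
  size-merge-≤ = begin
    size P ≡⟨ count-split (representative? P) (λ x → x ≟ rep P b) ⟩
    count (λ x → representative? P x ×-dec (x ≟ rep P b)) + count rest
      ≤⟨ +-mono-≤ one (count-mono rest (representative? merge) fixed) ⟩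
    1 + size merge ∎
    where
    open ℕₚ.≤-Reasoning
    rest : ∀ x → Dec (Representative P x × x ≢ rep P b)
    rest x = representative? P x ×-dec ¬? (x ≟ rep P b)
    one : count (λ x → representative? P x ×-dec (x ≟ rep P b)) ≤ 1
    one = sum-atMostOne _ (λ x → when-≤ (representative? P x ×-dec (x ≟ rep P b)) λ _ → ≤-refl)
      λ x y p q → trans (proj₂ (when-positive (representative? P x ×-dec (x ≟ rep P b)) p))
        (sym (proj₂ (when-positive (representative? P y ×-dec (y ≟ rep P b)) q)))
    fixed : ∀ x → Representative P x × x ≢ rep P b → merged x ≡ x
    fixed x (p , ne) with Partition._∼?_ P x b
    ... | yes e = contradiction (trans (sym p) e) ne
    ... | no _  = p

  merge-finest : (Q : Partition m) → related P ⇒ related Q → related Q a b → related merge ⇒ related Q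
  merge-finest Q P⇒Q ab = finest (merge-closure (record { generated = id ; finest = λ _ h → h }))
    (∼-equivalence Q) λ { (inj₁ r) → P⇒Q r ; (inj₂ (refl , refl)) → ab }

  size-merge-< : ¬ related P a b → size merge < size P
  size-merge-< a≁b = ℕₚ.≤-<-trans
    (count-mono (representative? merge) (λ x → representative? P x ×-dec ¬? (x ≟ rep P b)) fixed)
    (count-without-< (representative? P) (idem P b))
    where
    fixed : ∀ x → merged x ≡ x → Representative P x × x ≢ rep P b
    fixed x e with Partition._∼?_ P x b
    ... | yes p = contradiction (trans (sym (idem P a)) (trans (cong (rep P) e) p)) a≁b
    ... | no p  = e , λ { refl → p (idem P b) }

mergeAll : ∀ {m} → Partition m → ∀ k → (Fin k → Fin m) → (Fin k → Fin m) → Partition m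
mergeAll P zero    p q = P
mergeAll P (suc k) p q = merge (mergeAll P k (p ∘ suc) (q ∘ suc)) (p zero) (q zero)

mergeAll-closure : ∀ {m} (P : Partition m) k p q {S} → IsClosure P S →
  IsClosure (mergeAll P k p q) (λ x y → S x y ⊎ ∃ λ i → x ≡ p i × y ≡ q i)
mergeAll-closure P zero p q cl = record
  { generated = λ { (inj₁ s) → generated cl s }
  ; finest = λ eqv S⇒Q → finest cl eqv (S⇒Q ∘ inj₁) }
mergeAll-closure P (suc k) p q cl = record
  { generated = λ { (inj₁ s) → generated step-closure (inj₁ (inj₁ s))
                  ; (inj₂ (zero , e)) → generated step-closure (inj₂ e)
                  ; (inj₂ (suc i , e)) → generated step-closure (inj₁ (inj₂ (i , e))) }
  ; finest = λ eqv S⇒Q → finest step-closure eqv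
      λ { (inj₁ (inj₁ s)) → S⇒Q (inj₁ s) ; (inj₁ (inj₂ (i , e))) → S⇒Q (inj₂ (suc i , e)) ; (inj₂ e) → S⇒Q (inj₂ (zero , e)) } }
  where
  step-closure = merge-closure (mergeAll P k (p ∘ suc) (q ∘ suc)) (p zero) (q zero)
    (mergeAll-closure P k (p ∘ suc) (q ∘ suc) cl)

abstract
  -- The equivalence closure of x ∼ f x; for a permutation of a finite set its classes are the
  -- cycles.
  orbits : ∀ {m} → (Fin m → Fin m) → Partition m
  orbits {m} f = mergeAll discrete m id f

  -- For permutations, the orbits of the group generated by both: the connected components of a
  -- combinatorial map.
  components : ∀ {m} → (Fin m → Fin m) → (Fin m → Fin m) → Partition m
  components {m} f g = mergeAll (orbits f) m id g

  orbits-step : ∀ {m} (f : Fin m → Fin m) x → related (orbits f) x (f x)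
  orbits-step {m} f x = generated (mergeAll-closure discrete m id f discrete-closure) (inj₂ (x , refl , refl))

  orbits-finest : ∀ {m} (f : Fin m → Fin m) {Q : Rel (Fin m) 0ℓ} → IsEquivalence Q →
                  (∀ x → Q x (f x)) → related (orbits f) ⇒ Q
  orbits-finest {m} f eqv h = finest (mergeAll-closure discrete m id f discrete-closure) eqv
    λ { (inj₂ (x , refl , refl)) → h x }

  components-closure : ∀ {m} (f g : Fin m → Fin m) → IsClosure (components f g) (λ x y → y ≡ f x ⊎ y ≡ g x)
  components-closure {m} f g = record
    { generated = λ { {x} (inj₁ refl) → generated cl (inj₁ (inj₂ (x , refl , refl)))
                    ; {x} (inj₂ refl) → generated cl (inj₂ (x , refl , refl)) }
    ; finest = λ eqv S⇒Q → finest cl eqv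
        λ { (inj₁ (inj₂ (x , refl , refl))) → S⇒Q (inj₁ refl) ; (inj₂ (x , refl , refl)) → S⇒Q (inj₂ refl) } }
    where
    cl : IsClosure (components f g)
           (λ x y → (⊥ ⊎ ∃ λ i → x ≡ i × y ≡ f i) ⊎ ∃ λ i → x ≡ i × y ≡ g i)
    cl = mergeAll-closure (orbits f) m id g (mergeAll-closure discrete m id f discrete-closure)

components-step₁ : ∀ {m} (f g : Fin m → Fin m) x → related (components f g) x (f x)
components-step₁ f g x = generated (components-closure f g) (inj₁ refl)

components-step₂ : ∀ {m} (f g : Fin m → Fin m) x → related (components f g) x (g x)
components-step₂ f g x = generated (components-closure f g) (inj₂ refl)

components-finest : ∀ {m} (f g : Fin m → Fin m) {Q : Rel (Fin m) 0ℓ} → IsEquivalence Q →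
                    (∀ x → Q x (f x)) → (∀ x → Q x (g x)) → related (components f g) ⇒ Q
components-finest f g eqv h k = finest (components-closure f g) eqv
  λ { (inj₁ refl) → h _ ; (inj₂ refl) → k _ }

genus-same : ∀ {e c v f c′ v′ f′} → e + 2 * c ≤ v + f → v < v′ → f ≤ suc f′ → c′ ≤ c → e + 2 * c′ ≤ v′ + f′
genus-same {e} {c} {v} {f} {c′} {v′} {f′} g lt le lc = farkas (e + 2 * c′) (v′ + f′) 0
  (+-mono-≤ (+-mono-≤ g lt) (+-mono-≤ le (ℕₚ.*-monoʳ-≤ 2 lc))) (identity e c v f c′ v′ f′)
  where
  identity : ∀ e c v f c′ v′ f′ → e + 2 * c′ + (v + f + v′ + (1 + f′ + 2 * c)) + 0 ≡
                                  v′ + f′ + (e + 2 * c + (1 + v) + (f + 2 * c′))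
  identity = solve-∀

genus-split : ∀ {e c v f c′ v′ f′} → e + 2 * c ≤ v + f → v < v′ → f < f′ → c′ ≤ suc c → e + 2 * c′ ≤ v′ + f′
genus-split {e} {c} {v} {f} {c′} {v′} {f′} g lt le lc = farkas (e + 2 * c′) (v′ + f′) 0
  (+-mono-≤ (+-mono-≤ g lt) (+-mono-≤ le (ℕₚ.*-monoʳ-≤ 2 lc))) (identity e c v f c′ v′ f′)
  where
  identity : ∀ e c v f c′ v′ f′ → e + 2 * c′ + (v + f + v′ + (f′ + 2 * (1 + c))) + 0 ≡
                                  v′ + f′ + (e + 2 * c + (1 + v) + (1 + f + 2 * c′))
  identity = solve-∀

-- Detaching a dart from a combinatorial map

module _ {m : ℕ} where

  private
    τ-view : ∀ (a b x : Fin m) →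
      (x ≡ a × transpose a b ⟨$⟩ʳ x ≡ b) ⊎ (x ≢ a × x ≡ b × transpose a b ⟨$⟩ʳ x ≡ a) ⊎
      (x ≢ a × x ≢ b × transpose a b ⟨$⟩ʳ x ≡ x)
    τ-view a b x with x ≟ a
    ... | yes x≡a = inj₁ (x≡a , refl)
    ... | no x≢a with x ≟ b
    ...   | yes x≡b = inj₂ (inj₁ (x≢a , x≡b , refl))
    ...   | no x≢b = inj₂ (inj₂ (x≢a , x≢b , refl))

  -- If q arises from a permutation p by transposing a and b after it, and p has a
  -- and b in different orbits, then q merges these orbits: otherwise p would map
  -- the q-orbit of a within the p-orbit of a into itself without reaching a.
  transposition-merges : (p : Permutation′ m) (q : Fin m → Fin m) (a b : Fin m) →
    (∀ x → q x ≡ transpose a b ⟨$⟩ʳ (p ⟨$⟩ʳ x)) →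
    ¬ related (orbits (p ⟨$⟩ʳ_)) a b → related (orbits q) a b
  transposition-merges p q a b q≡ a≁b = decidable-stable (Partition._∼?_ (orbits q) a b) λ a≁ᵠb →
    let Zp = related (orbits (p ⟨$⟩ʳ_))
        Zq = related (orbits q)
        Z : Fin m → Set
        Z x = Zp x a × Zq x a
        Z? : ∀ x → Dec (Z x)
        Z? x = Partition._∼?_ (orbits (p ⟨$⟩ʳ_)) x a ×-dec Partition._∼?_ (orbits q) x a
        p-step : ∀ x → Zp x (p ⟨$⟩ʳ x)
        p-step = orbits-step (p ⟨$⟩ʳ_)
        maps : ∀ x → Z x → Z (p ⟨$⟩ʳ x) × p ⟨$⟩ʳ x ≢ a
        maps x (zp , zq) = case-τ x zp zq (trans (sym (p-step x)) zp) a≁ᵠb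
    in ℕₚ.<-irrefl refl (ℕₚ.≤-<-trans
         (count-injection Z? (λ x → Z? x ×-dec ¬? (x ≟ a)) (p ⟨$⟩ʳ_) maps
           (λ x y _ _ e → trans (sym (inverseˡ p)) (trans (cong (p ⟨$⟩ˡ_) e) (inverseˡ p))))
         (count-without-< Z? (refl , refl)))
    where
    case-τ : ∀ x → related (orbits (p ⟨$⟩ʳ_)) x a → related (orbits q) x a →
             related (orbits (p ⟨$⟩ʳ_)) (p ⟨$⟩ʳ x) a → ¬ related (orbits q) a b →
             (related (orbits (p ⟨$⟩ʳ_)) (p ⟨$⟩ʳ x) a × related (orbits q) (p ⟨$⟩ʳ x) a) × p ⟨$⟩ʳ x ≢ a
    case-τ x zp zq zp′ a≁ᵠb with τ-view a b (p ⟨$⟩ʳ x)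
    ... | inj₁ (px≡a , τ≡b) = contradiction
            (trans (sym zq) (trans (orbits-step q x) (cong (rep (orbits q)) (trans (q≡ x) τ≡b)))) a≁ᵠb
    ... | inj₂ (inj₁ (_ , px≡b , _)) = contradiction (sym (subst (λ z → related (orbits (p ⟨$⟩ʳ_)) z a) px≡b zp′)) a≁b
    ... | inj₂ (inj₂ (px≢a , _ , τ≡)) = (zp′ ,
            trans (cong (rep (orbits q)) (sym (trans (q≡ x) τ≡))) (trans (sym (orbits-step q x)) zq)) , px≢a

  module _ (α : Fin m → Fin m) where

    -- Euler's formula as the inequality 2C ≤ V - E + F, for the vertex permutation `σ`, the edge
    -- involution `α` and the face permutation `σ ∘ α`. The number of edges is a parameter, since
    -- `α` stays fixed while `σ` varies.
    Genus₀ : ℕ → (Fin m → Fin m) → Set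
    Genus₀ e σ = e + 2 * size (components σ α) ≤ size (orbits σ) + size (orbits (σ ∘ α))

    -- Bypasses `a`: it becomes a fixed point, and its predecessor is sent to its former successor.
    detach : Permutation′ m → Fin m → Permutation′ m
    detach σ a = σ ∘ₚ transpose a (σ ⟨$⟩ʳ a)

    module _ (σ : Permutation′ m) (α-perm : Permutation′ m) (α≡ : ∀ x → α-perm ⟨$⟩ʳ x ≡ α x) (a : Fin m) where

      private
        b = σ ⟨$⟩ʳ a
        σ′ = detach σ a
        f = σ ⟨$⟩ʳ_
        f′ = σ′ ⟨$⟩ʳ_
        τ = transpose a b ⟨$⟩ʳ_

        f-injective : ∀ {x y} → f x ≡ f y → x ≡ y
        f-injective e = trans (sym (inverseˡ σ)) (trans (cong (σ ⟨$⟩ˡ_) e) (inverseˡ σ))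

      detach-view : ∀ x → (x ≡ a × f′ x ≡ a) ⊎ (x ≢ a × f x ≡ a × f′ x ≡ b) ⊎ (x ≢ a × f x ≢ a × f′ x ≡ f x)
      detach-view x with τ-view a b (f x)
      ... | inj₂ (inj₁ (_ , fx≡b , τ≡a)) = inj₁ (f-injective fx≡b , τ≡a)
      ... | inj₂ (inj₂ (fx≢a , fx≢b , τ≡)) = inj₂ (inj₂ ((λ { refl → fx≢b refl }) , fx≢a , τ≡))
      ... | inj₁ (fx≡a , τ≡b) with x ≟ a
      ...   | yes refl = inj₁ (refl , trans τ≡b fx≡a)
      ...   | no x≢a = inj₂ (inj₁ (x≢a , fx≡a , τ≡b))

      detach-fixes : f′ a ≡ a
      detach-fixes with detach-view a
      ... | inj₁ (_ , e) = e
      ... | inj₂ (inj₁ (ne , _)) = contradiction refl ne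
      ... | inj₂ (inj₂ (ne , _)) = contradiction refl ne

      private
        τ-related : ∀ (P : Partition m) → related P a b → ∀ x → related P (τ x) x
        τ-related P ab x with τ-view a b x
        ... | inj₁ (refl , e) = trans (cong (rep P) e) (sym ab)
        ... | inj₂ (inj₁ (_ , refl , e)) = trans (cong (rep P) e) ab
        ... | inj₂ (inj₂ (_ , _ , e)) = cong (rep P) e

        -- f and f′ differ by the transposition of a and b, so a partition that joins
        -- a and b is preserved by both or by none.
        reattach : ∀ (P : Partition m) {g : Fin m → Fin m} → related P a b →
                   (∀ x → related P x (f′ (g x))) → ∀ x → related P x (f (g x))
        reattach P {g} ab h x = trans (h x) (τ-related P ab (f (g x)))

        unattach : ∀ (P : Partition m) {g : Fin m → Fin m} → related P a b →
                   (∀ x → related P x (f (g x))) → ∀ x → related P x (f′ (g x))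
        unattach P {g} ab h x = trans (h x) (sym (τ-related P ab (f (g x))))

        φ  = f ∘ α
        φ′ = f′ ∘ α

      -- Joining `a` and `b` in the orbits of `f′` still gives a refinement of the orbits of `f`,
      -- and `a` is alone in its orbit under `f′`.
      vertex-split : a ≢ b → size (orbits f) < size (orbits f′)
      vertex-split a≢b = ℕₚ.≤-<-trans
        (size-mono (merge (orbits f′) a b) (orbits f) (merge-finest (orbits f′) a b (orbits f)
          (orbits-finest f′ (∼-equivalence (orbits f)) (unattach (orbits f) {id} (orbits-step f a) (orbits-step f)))
          (orbits-step f a)))
        (size-merge-< (orbits f′) a b apart)
        where
        stay : ∀ x → (x ≡ a → f′ x ≡ a) × (f′ x ≡ a → x ≡ a)
        stay x = (λ { refl → detach-fixes }) , λ e → trans (sym (inverseˡ σ′)) (trans (cong (σ′ ⟨$⟩ˡ_) (trans e (sym detach-fixes))) (inverseˡ σ′))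
        apart : ¬ related (orbits f′) a b
        apart r = a≢b (sym (proj₁ (orbits-finest f′ (iff-equivalence (_≡ a)) stay r) refl))

      faces-≤ : size (orbits φ) ≤ suc (size (orbits φ′))
      faces-≤ = ≤-trans (size-merge-≤ (orbits φ) a b) (s≤s (size-mono (orbits φ′) M
        (orbits-finest φ′ (∼-equivalence M) (unattach M {α} (merge-joins (orbits φ) a b)
          λ x → merge-coarser (orbits φ) a b (orbits-step φ x)))))
        where M = merge (orbits φ) a b

      -- `φ` is `φ′` followed by the transposition, so by `transposition-merges` it joins the two
      -- orbits that `φ′` keeps apart.
      faces-< : ¬ related (orbits φ′) a b → size (orbits φ) < size (orbits φ′)
      faces-< a≁b = ℕₚ.≤-<-trans
        (size-mono (merge (orbits φ′) a b) (orbits φ) (merge-finest (orbits φ′) a b (orbits φ)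
          (orbits-finest φ′ (∼-equivalence (orbits φ)) (unattach (orbits φ) {α} joined (orbits-step φ)))
          joined))
        (size-merge-< (orbits φ′) a b a≁b)
        where
        perm = α-perm ∘ₚ σ′
        perm≡ : ∀ x → perm ⟨$⟩ʳ x ≡ φ′ x
        perm≡ x = cong f′ (α≡ x)
        τ-involutive : ∀ x → τ (τ x) ≡ x
        τ-involutive x with τ-view a b x
        ... | inj₁ (refl , e) = trans (cong τ e) (transpose-b (τ-view a b b))
          where
          transpose-b : (b ≡ a × τ b ≡ b) ⊎ (b ≢ a × b ≡ b × τ b ≡ a) ⊎ (b ≢ a × b ≢ b × τ b ≡ b) → τ b ≡ a
          transpose-b (inj₁ (b≡a , e)) = trans e b≡a
          transpose-b (inj₂ (inj₁ (_ , _ , e))) = e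
          transpose-b (inj₂ (inj₂ (_ , ne , _))) = contradiction refl ne
        ... | inj₂ (inj₁ (_ , refl , e)) = trans (cong τ e) (transpose-a (τ-view a b a))
          where
          transpose-a : (a ≡ a × τ a ≡ b) ⊎ (a ≢ a × a ≡ b × τ a ≡ a) ⊎ (a ≢ a × a ≢ b × τ a ≡ a) → τ a ≡ b
          transpose-a (inj₁ (_ , e)) = e
          transpose-a (inj₂ (inj₁ (ne , _))) = contradiction refl ne
          transpose-a (inj₂ (inj₂ (ne , _))) = contradiction refl ne
        ... | inj₂ (inj₂ (_ , _ , e)) = trans (cong τ e) e
        joined : related (orbits φ) a b
        joined = transposition-merges perm φ a b
          (λ x → sym (trans (cong τ (perm≡ x)) (τ-involutive (φ x))))
          λ r → a≁b (orbits-finest (perm ⟨$⟩ʳ_) (∼-equivalence (orbits φ′))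
            (λ x → trans (orbits-step φ′ x) (cong (rep (orbits φ′)) (sym (perm≡ x)))) r)

      components-≤ : size (components f′ α) ≤ suc (size (components f α))
      components-≤ = ≤-trans (size-merge-≤ (components f′ α) a b) (s≤s (size-mono (components f α) M
        (components-finest f α (∼-equivalence M)
          (reattach M {id} (merge-joins (components f′ α) a b) λ x → merge-coarser (components f′ α) a b (components-step₁ f′ α x))
          λ x → merge-coarser (components f′ α) a b (components-step₂ f′ α x))))
        where M = merge (components f′ α) a b

      components-same : related (components f′ α) a b → size (components f′ α) ≤ size (components f α)
      components-same ab = size-mono (components f α) P (components-finest f α (∼-equivalence P)
        (reattach P {id} ab (components-step₁ f′ α)) (components-step₂ f′ α))
        where P = components f′ α

      φ′-in-components : related (orbits φ′) ⇒ related (components f′ α)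
      φ′-in-components = orbits-finest φ′ (∼-equivalence (components f′ α))
        λ x → trans (components-step₂ f′ α x) (components-step₁ f′ α (α x))

      -- If `a` and `b` stay in one component, none is gained, and the new vertex makes up for a
      -- face that may be lost. Otherwise they also lie on different faces, as faces stay inside
      -- components; the new vertex and the new face then pay for the new component, which counts
      -- twice.
      genus-detach : ∀ {e} → a ≢ b → Genus₀ e f → Genus₀ e f′
      genus-detach {e} a≢b g = by-component (Partition._∼?_ (components f′ α) a b)
        where
        by-component : Dec (related (components f′ α) a b) → Genus₀ e f′
        by-component (yes ab) = genus-same {e} g (vertex-split a≢b) faces-≤ (components-same ab)
        by-component (no ¬ab) = genus-split {e} g (vertex-split a≢b) (faces-< (¬ab ∘ φ′-in-components)) components-≤

      -- Under the map that sends `a` to its successor `b` and fixes the rest, every step of `f`,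
      -- also into or out of `a`, stays within an orbit of `f′`.
      orbit-detach : ∀ {x y} → x ≢ a → y ≢ a → related (orbits f) x y → related (orbits f′) x y
      orbit-detach {x} {y} x≢a y≢a r = subst₂ (related P) (shift-other x≢a) (shift-other y≢a)
        (orbits-finest f (On.isEquivalence shift (∼-equivalence P)) shift-step r)
        where
        P = orbits f′
        shift-by : ∀ {z} → Dec (z ≡ a) → Fin m
        shift-by (yes _) = b
        shift-by {z} (no _) = z
        shift : Fin m → Fin m
        shift z = shift-by (z ≟ a)
        shift-other : ∀ {z} → z ≢ a → shift z ≡ z
        shift-other {z} z≢a with z ≟ a
        ... | yes e = contradiction e z≢a
        ... | no _ = refl
        shift-a : shift a ≡ b
        shift-a with a ≟ a
        ... | yes _ = refl
        ... | no ne = contradiction refl ne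
        shift-b : shift b ≡ b
        shift-b with b ≟ a
        ... | yes _ = refl
        ... | no _ = refl
        shift-step : ∀ z → related P (shift z) (shift (f z))
        shift-step z with detach-view z
        ... | inj₁ (refl , _) = cong (rep P) (trans shift-a (sym shift-b))
        ... | inj₂ (inj₁ (z≢a , fz≡a , e)) = trans (cong (rep P) (shift-other z≢a))
                (trans (orbits-step f′ z) (cong (rep P) (trans e (sym (trans (cong shift fz≡a) shift-a)))))
        ... | inj₂ (inj₂ (z≢a , fz≢a , e)) = trans (cong (rep P) (shift-other z≢a))
                (trans (orbits-step f′ z) (cong (rep P) (trans e (sym (shift-other fz≢a)))))

    -- The invariant of detaching, in turn, all elements outside K; the first k
    -- elements have been treated.
    record Detached (e : ℕ) {X : Set} (src : Fin m → X) (K : Fin m → Set) (k : ℕ) : Set where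
      field
        σ       : Permutation′ m
        genus   : Genus₀ e (σ ⟨$⟩ʳ_)
        src-σ   : ∀ x → src (σ ⟨$⟩ʳ x) ≡ src x
        around  : ∀ {x y} → K x → K y → src x ≡ src y → related (orbits (σ ⟨$⟩ʳ_)) x y
        removed : ∀ x → toℕ x < k → ¬ K x → σ ⟨$⟩ʳ x ≡ x

    module _ (α-perm : Permutation′ m) (α≡ : ∀ x → α-perm ⟨$⟩ʳ x ≡ α x)
             {e : ℕ} {X : Set} {src : Fin m → X} {K : Fin m → Set} (K? : ∀ x → Dec (K x)) where

      detachAll : Detached e src K 0 → ∀ k → k ≤ m → Detached e src K k
      detachAll start zero _ = start
      detachAll start (suc k) k<m = extend (K? a) (a ≟ (σ ⟨$⟩ʳ a))
        where
        open Detached (detachAll start k (ℕₚ.<⇒≤ k<m))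
        a = fromℕ< k<m
        same : (¬ K a → σ ⟨$⟩ʳ a ≡ a) → Detached e src K (suc k)
        same h = record
          { σ = σ ; genus = genus ; src-σ = src-σ ; around = around
          ; removed = λ x x< ¬Kx → by-case (ℕₚ.m≤n⇒m<n∨m≡n (ℕₚ.≤-pred x<)) ¬Kx }
          where
          by-case : ∀ {x} → toℕ x < k ⊎ toℕ x ≡ k → ¬ K x → σ ⟨$⟩ʳ x ≡ x
          by-case (inj₁ lt) ¬Kx = removed _ lt ¬Kx
          by-case {x} (inj₂ eq) with toℕ-injective (trans eq (sym (toℕ-fromℕ< k<m)))
          ... | refl = h
        extend : Dec (K a) → Dec (a ≡ σ ⟨$⟩ʳ a) → Detached e src K (suc k)
        extend (yes Ka) _ = same (λ ¬Ka → contradiction Ka ¬Ka)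
        -- A dart that is already a fixed point is left alone, as no vertex would be gained.
        extend (no _) (yes fixed) = same (λ _ → sym fixed)
        extend (no ¬Ka) (no moved) = record
          { σ = detach σ a
          ; genus = genus-detach σ α-perm α≡ a {e} moved genus
          ; src-σ = src′
          ; around = λ Kx Ky eq → orbit-detach σ α-perm α≡ a (λ { refl → ¬Ka Kx }) (λ { refl → ¬Ka Ky }) (around Kx Ky eq)
          ; removed = λ x x< ¬Kx → by-case (ℕₚ.m≤n⇒m<n∨m≡n (ℕₚ.≤-pred x<)) ¬Kx }
          where
          src′ : ∀ x → src (detach σ a ⟨$⟩ʳ x) ≡ src x
          src′ x with detach-view σ α-perm α≡ a x
          ... | inj₁ (refl , eq) = cong src eq
          ... | inj₂ (inj₁ (_ , fx≡a , eq)) = trans (cong src eq) (trans (src-σ a) (trans (cong src (sym fx≡a)) (src-σ x)))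
          ... | inj₂ (inj₂ (_ , _ , eq)) = trans (cong src eq) (src-σ x)
          by-case : ∀ {x} → toℕ x < k ⊎ toℕ x ≡ k → ¬ K x → detach σ a ⟨$⟩ʳ x ≡ x
          by-case {x} (inj₂ eq) _ with toℕ-injective (trans eq (sym (toℕ-fromℕ< k<m)))
          ... | refl = detach-fixes σ α-perm α≡ a
          by-case {x} (inj₁ lt) ¬Kx with detach-view σ α-perm α≡ a x
          ... | inj₁ (refl , eq) = eq
          -- A dart fixed earlier cannot be the predecessor of `a`, so it stays fixed.
          ... | inj₂ (inj₁ (x≢a , fx≡a , _)) = contradiction (trans (sym (removed x lt ¬Kx)) fx≡a) x≢a
          ... | inj₂ (inj₂ (_ , _ , eq)) = trans eq (removed x lt ¬Kx)

  -- Counting orbits by their length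

  iterate : (Fin m → Fin m) → ℕ → Fin m → Fin m
  iterate q zero    x = x
  iterate q (suc i) x = iterate q i (q x)

  iterate-related : ∀ q i x → related (orbits q) x (iterate q i x)
  iterate-related q zero    x = refl
  iterate-related q (suc i) x = trans (orbits-step q x) (iterate-related q i (q x))

  sum-iterate : ∀ (q : Permutation′ m) (w : Fin m → ℕ) i → sum (w ∘ iterate (q ⟨$⟩ʳ_) i) ≡ sum w
  sum-iterate q w zero    = refl
  sum-iterate q w (suc i) = trans (sym (sum-permute (w ∘ iterate (q ⟨$⟩ʳ_) i) q)) (sum-iterate q w i)

  -- Count the pairs of i < k and x whose i-th iterate is a representative in `P`: there are k for
  -- each representative, as iteration permutes the elements, and at most one for each x in `P`, as
  -- its first k iterates are distinct and share one representative.
  long-orbits : ∀ (q : Permutation′ m) {P : Fin m → Set} (P? : ∀ x → Dec (P x)) k →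
    (∀ x → P (q ⟨$⟩ʳ x) → P x) →
    (∀ x → P x → ∀ i j → i < j → j < k → iterate (q ⟨$⟩ʳ_) i x ≢ iterate (q ⟨$⟩ʳ_) j x) →
    k * count (λ x → representative? (orbits (q ⟨$⟩ʳ_)) x ×-dec P? x) ≤ count P?
  long-orbits q {P} P? k back distinct = begin
    k * count F?                                      ≡⟨ sym (sum-const k (count F?)) ⟩
    sum {k} (λ _ → count F?)                          ≡⟨ sum-cong-≗ {k} (λ i → sym (sum-iterate q (λ x → when (F? x) 1) (toℕ i))) ⟩
    sum {k} (λ i → sum (λ x → hit i x))               ≡⟨ ∑-comm hit ⟩
    sum (λ x → sum {k} (λ i → hit i x))               ≤⟨ sum-mono column ⟩
    count P?                                          ∎
    where
    open ℕₚ.≤-Reasoning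
    f = q ⟨$⟩ʳ_
    O = orbits f
    F? : ∀ x → Dec (Representative O x × P x)
    F? x = representative? O x ×-dec P? x
    hit : Fin k → Fin m → ℕ
    hit i x = when (F? (iterate f (toℕ i) x)) 1
    backs : ∀ i x → P (iterate f i x) → P x
    backs zero    x p = p
    backs (suc i) x p = back x (backs i (f x) p)
    column : ∀ x → sum {k} (λ i → hit i x) ≤ when (P? x) 1
    column x = by-P (P? x)
      where
      hit-view : ∀ i → 1 ≤ hit i x → Representative O (iterate f (toℕ i) x) × P (iterate f (toℕ i) x)
      hit-view i = when-positive (F? (iterate f (toℕ i) x))
      by-P : (d : Dec (P x)) → sum {k} (λ i → hit i x) ≤ when d 1
      by-P (no ¬p) = ≤-reflexive (sum-zero {k} {λ i → hit i x} λ i → when-no (F? (iterate f (toℕ i) x)) λ h → ¬p (backs (toℕ i) x (proj₂ h)))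
      by-P (yes p) = sum-atMostOne (λ i → hit i x) (λ i → when-≤ (F? (iterate f (toℕ i) x)) λ _ → ≤-refl) λ i j h h′ →
        unique i j (representative-unique O (proj₁ (hit-view i h)) (proj₁ (hit-view j h′))
          (trans (sym (iterate-related f (toℕ i) x)) (iterate-related f (toℕ j) x)))
        where
        unique : ∀ (i j : Fin k) → iterate f (toℕ i) x ≡ iterate f (toℕ j) x → i ≡ j
        unique i j e with ℕₚ.<-cmp (toℕ i) (toℕ j)
        ... | tri< l _ _ = contradiction e (distinct x p (toℕ i) (toℕ j) l (toℕ<n j))
        ... | tri≈ _ eq _ = toℕ-injective eq
        ... | tri> _ _ l = contradiction (sym e) (distinct x p (toℕ j) (toℕ i) l (toℕ<n i))

  -- Every element of `Z` is a representative or is sent to one by `α`.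
  short-classes : ∀ (P : Partition m) (α : Permutation′ m) {Z : Fin m → Set} (Z? : ∀ x → Dec (Z x)) →
    (∀ x → Z x → Z (α ⟨$⟩ʳ x)) →
    (∀ x → Z x → rep P x ≡ x ⊎ rep P x ≡ α ⟨$⟩ʳ x) →
    count Z? ≤ 2 * count (λ x → representative? P x ×-dec Z? x)
  short-classes P α {Z} Z? closed short = begin
    count Z?                                              ≤⟨ sum-mono pointwise ⟩
    sum (λ x → when (F? x) 1 + when (F? (α ⟨$⟩ʳ x)) 1)     ≡⟨ ∑-distrib-+ (λ x → when (F? x) 1) (λ x → when (F? (α ⟨$⟩ʳ x)) 1) ⟩
    count F? + sum (λ x → when (F? (α ⟨$⟩ʳ x)) 1)          ≡⟨ cong (count F? +_) (sym (sum-permute (λ x → when (F? x) 1) α)) ⟩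
    count F? + count F?                                   ≡⟨ cong (count F? +_) (sym (ℕₚ.+-identityʳ (count F?))) ⟩
    2 * count F?                                          ∎
    where
    open ℕₚ.≤-Reasoning
    F? : ∀ x → Dec (Representative P x × Z x)
    F? x = representative? P x ×-dec Z? x
    pointwise : ∀ x → when (Z? x) 1 ≤ when (F? x) 1 + when (F? (α ⟨$⟩ʳ x)) 1
    pointwise x = when-≤ (Z? x) λ z → by-rep z (short x z)
      where
      by-rep : Z x → rep P x ≡ x ⊎ rep P x ≡ α ⟨$⟩ʳ x → 1 ≤ when (F? x) 1 + when (F? (α ⟨$⟩ʳ x)) 1
      by-rep z (inj₁ e) = ≤-trans (≤-reflexive (sym (when-yes (F? x) (e , z)))) (m≤m+n _ _)
      by-rep z (inj₂ e) = ≤-trans (≤-reflexive (sym (when-yes (F? (α ⟨$⟩ʳ x))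
        (trans (cong (rep P) (sym e)) (trans (idem P x) e) , closed x z)))) (ℕₚ.m≤n+m _ _)

-- Euler's bound for subgraphs of a planar graph

enumerate : ∀ N (b : Fin N → Bool) → ∃ λ m → Σ (Fin N) (T ∘ b) ↔ Fin m
enumerate zero b = 0 , mk↔ₛ′ (λ ()) (λ ()) (λ ()) (λ ())
enumerate (suc N) b = with-head (b zero) refl (enumerate N (b ∘ suc))
  where
  with-head : ∀ c → b zero ≡ c → (∃ λ m → Σ (Fin N) (T ∘ b ∘ suc) ↔ Fin m) → ∃ λ m → Σ (Fin (suc N)) (T ∘ b) ↔ Fin m
  with-head true eq (m , E) = suc m , mk↔ₛ′ to from to-from from-to
    where
    to : Σ (Fin (suc N)) (T ∘ b) → Fin (suc m)
    to (zero , _) = zero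
    to (suc i , p) = suc (Inverse.to E (i , p))
    from : Fin (suc m) → Σ (Fin (suc N)) (T ∘ b)
    from zero = zero , subst T (sym eq) _
    from (suc j) = let i , p = Inverse.from E j in suc i , p
    to-from : ∀ j → to (from j) ≡ j
    to-from zero = refl
    to-from (suc j) = cong suc (Inverse.strictlyInverseˡ E j)
    from-to : ∀ x → from (to x) ≡ x
    from-to (zero , p) = cong (zero ,_) (T-irrelevant _ _)
    from-to (suc i , p) = cong (λ (i , p) → suc i , p) (Inverse.strictlyInverseʳ E (i , p))
  with-head false eq (m , E) = m , mk↔ₛ′ to from (Inverse.strictlyInverseˡ E) from-to
    where
    to : Σ (Fin (suc N)) (T ∘ b) → Fin m
    to (zero , p) = ⊥-elim (subst T eq p)
    to (suc i , p) = Inverse.to E (i , p)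
    from : Fin m → Σ (Fin (suc N)) (T ∘ b)
    from j = let i , p = Inverse.from E j in suc i , p
    from-to : ∀ x → from (to x) ≡ x
    from-to (zero , p) = ⊥-elim (subst T eq p)
    from-to (suc i , p) = cong (λ (i , p) → suc i , p) (Inverse.strictlyInverseʳ E (i , p))

dart-ext : ∀ {n} {G : Graph n} {d d′ : Dart G} → source d ≡ source d′ → target d ≡ target d′ → d ≡ d′
dart-ext {d = dart u v e} {dart _ _ e′} refl refl = cong (dart u v) (T-irrelevant e e′)

enumerateDarts : ∀ {n} (G : Graph n) → ∃ λ m → Dart G ↔ Fin m
enumerateDarts {n} G = proj₁ pairs , ↔-trans dart↔pair (proj₂ pairs)
  where
  ends : Fin (n * n) → Fin n × Fin n
  ends = remQuot n
  isEdge : Fin (n * n) → Bool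
  isEdge i = Graph.adjacent G (proj₁ (ends i)) (proj₂ (ends i))
  pairs = enumerate (n * n) isEdge
  to : Dart G → Σ (Fin (n * n)) (T ∘ isEdge)
  to (dart u v e) = combine u v , subst (λ (u , v) → Adj G u v) (sym (remQuot-combine u v)) e
  from : Σ (Fin (n * n)) (T ∘ isEdge) → Dart G
  from (i , e) = dart (proj₁ (ends i)) (proj₂ (ends i)) e
  pair-ext : ∀ {x y : Σ (Fin (n * n)) (T ∘ isEdge)} → proj₁ x ≡ proj₁ y → x ≡ y
  pair-ext refl = cong (_ ,_) (T-irrelevant _ _)
  dart↔pair : Dart G ↔ Σ (Fin (n * n)) (T ∘ isEdge)
  dart↔pair = mk↔ₛ′ to from (λ x → pair-ext (combine-remQuot {n} n (proj₁ x)))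
    (λ d → dart-ext (cong proj₁ (remQuot-combine (source d) (target d))) (cong proj₂ (remQuot-combine (source d) (target d))))

module _ {A : Set} {m : ℕ} (E : A ↔ Fin m) where

  private
    to = Inverse.to E
    from = Inverse.from E

  module _ {R : A → A → Set} {k : ℕ} (classes : HasClasses R k) (P : Partition m) where

    private
      class = Surjection.to (proj₁ classes)

    classes-≤ : (∀ {x y} → related P x y → class (from x) ≡ class (from y)) → k ≤ size P
    classes-≤ h = subst (_≤ size P) (count-all k) (count-injection (λ _ → yes tt) (representative? P)
      (λ i → rep P (to (section i))) (λ i _ → idem P (to (section i)))
      λ i j _ _ e → trans (sym (section-class i)) (trans (h e) (section-class j)))
      where
      section : Fin k → A
      section i = proj₁ (Surjection.strictlySurjective (proj₁ classes) i)
      section-class : ∀ i → class (from (to (section i))) ≡ i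
      section-class i = trans (cong class (Inverse.strictlyInverseʳ E (section i)))
        (proj₂ (Surjection.strictlySurjective (proj₁ classes) i))

    size-≤ : (∀ a b → R a b → related P (to a) (to b)) → size P ≤ k
    size-≤ h = subst (size P ≤_) (count-all k) (count-injection (representative? P) (λ _ → yes tt)
      (class ∘ from) (λ _ _ → tt)
      λ x y p q e → representative-unique P p q (subst₂ (related P)
        (Inverse.strictlyInverseˡ E x) (Inverse.strictlyInverseˡ E y)
        (h (from x) (from y) (Equivalence.from (proj₂ classes (from x) (from y)) e))))

  module _ (g : A → A) (ĝ : Fin m → Fin m) (ĝ≡ : ∀ x → ĝ x ≡ to (g (from x))) where

    sameOrbit⇒related : ∀ {a b} → SameOrbit g a b → related (orbits ĝ) (to a) (to b)
    sameOrbit⇒related {a} (k , refl) = iterates k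
      where
      iterates : ∀ k → related (orbits ĝ) (to a) (to (fold a g k))
      iterates zero = refl
      iterates (suc k) = trans (iterates k) (trans (orbits-step ĝ (to (fold a g k)))
        (cong (rep (orbits ĝ)) (trans (ĝ≡ _) (cong (to ∘ g) (Inverse.strictlyInverseʳ E (fold a g k))))))

    orbits-≤ : ∀ {k} → HasClasses (SameOrbit g) k → size (orbits ĝ) ≤ k
    orbits-≤ classes = size-≤ classes (orbits ĝ) λ a b → sameOrbit⇒related

    orbits-≥ : ∀ {k} → HasClasses (SameOrbit g) k → k ≤ size (orbits ĝ)
    orbits-≥ classes = classes-≤ classes (orbits ĝ) (orbits-finest ĝ
      {λ x y → Surjection.to (proj₁ classes) (from x) ≡ Surjection.to (proj₁ classes) (from y)}
      (On.isEquivalence (Surjection.to (proj₁ classes) ∘ from) isEquivalence)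
      λ x → Equivalence.to (proj₂ classes (from x) (from (ĝ x)))
        (1 , sym (trans (cong from (ĝ≡ x)) (Inverse.strictlyInverseʳ E (g (from x))))))

fibre-sum : ∀ {m n} (g : Fin m → Fin n) (w : Fin m → ℕ) →
            sum (λ v → sum (λ x → when (g x ≟ v) (w x))) ≡ sum w
fibre-sum g w = trans (∑-comm λ v x → when (g x ≟ v) (w x)) (sum-cong-≗ λ x →
  trans (sum-single (λ v → when (g x ≟ v) (w x)) (g x) (λ v ne → when-no (g x ≟ v) (ne ∘ sym)))
    (when-yes (g x ≟ g x) refl))

-- Here e, c, v, f count edges, components, vertices and faces of the detached map, p the
-- non-isolated vertices of the subgraph and D its degree sum; h and s count kept and removed darts,
-- and the superscripts mark kept (K) and removed (N) classes. A removed pair of darts accounts for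
-- 2 vertices, 1 edge, 1 face and 1 component, which cancel; Euler's formula with faces of length at
-- least 7 remains.
euler-arithmetic : ∀ {e c v f p s h fᴷ fᴺ cᴷ cᴺ D} → e + 2 * c ≤ v + f → v ≤ p + s → f ≤ fᴷ + fᴺ →
  7 * fᴷ ≤ h → 2 * fᴺ ≤ s → s + h ≤ 2 * e → cᴺ + cᴷ ≤ c → s ≤ 2 * cᴺ → 1 ≤ cᴷ → D ≤ h →
  5 * D + 28 ≤ 14 * p
euler-arithmetic {e} {c} {v} {f} {p} {s} {h} {fᴷ} {fᴺ} {cᴷ} {cᴺ} {D} h₁ h₂ h₃ h₄ h₅ h₆ h₇ h₈ h₉ h₀ =
  farkas (5 * D + 28) (14 * p) 0
    (+-mono-≤ (+-mono-≤ (+-mono-≤ (+-mono-≤ (+-mono-≤ (+-mono-≤ (+-mono-≤ (+-mono-≤ (+-mono-≤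
      (ℕₚ.*-monoʳ-≤ 14 h₁) (ℕₚ.*-monoʳ-≤ 14 h₂)) (ℕₚ.*-monoʳ-≤ 14 h₃)) (ℕₚ.*-monoʳ-≤ 2 h₄))
      (ℕₚ.*-monoʳ-≤ 7 h₅)) (ℕₚ.*-monoʳ-≤ 7 h₆)) (ℕₚ.*-monoʳ-≤ 28 h₇)) (ℕₚ.*-monoʳ-≤ 14 h₈))
      (ℕₚ.*-monoʳ-≤ 28 h₉)) (ℕₚ.*-monoʳ-≤ 5 h₀))
    (identity e c v f p s h fᴷ fᴺ cᴷ cᴺ D)
  where
  identity : ∀ e c v f p s h fᴷ fᴺ cᴷ cᴺ D →
    5 * D + 28 + (14 * (v + f) + 14 * (p + s) + 14 * (fᴷ + fᴺ) + 2 * h + 7 * s + 7 * (2 * e) + 28 * c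
      + 14 * (2 * cᴺ) + 28 * cᴷ + 5 * h) + 0 ≡
    14 * p + (14 * (e + 2 * c) + 14 * v + 14 * f + 2 * (7 * fᴷ) + 7 * (2 * fᴺ) + 7 * (s + h)
      + 28 * (cᴺ + cᴷ) + 14 * s + 28 * 1 + 5 * D)
  identity = solve-∀

module _ {n : ℕ} (G : Graph n) (planar : Planar G) where

  open Planar planar
  open RotationSystem rotationSystem

  private
    m = proj₁ (enumerateDarts G)
    E = proj₂ (enumerateDarts G)

    ι : Dart G → Fin m
    ι = Inverse.to E
    δ : Fin m → Dart G
    δ = Inverse.from E

    ι-δ : ∀ x → ι (δ x) ≡ x
    ι-δ = Inverse.strictlyInverseˡ E
    δ-ι : ∀ d → δ (ι d) ≡ d
    δ-ι = Inverse.strictlyInverseʳ E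

    src tgt : Fin m → Fin n
    src = source ∘ δ
    tgt = target ∘ δ

    α : Fin m → Fin m
    α x = ι (reverse G (δ x))

    src-α : ∀ x → src (α x) ≡ tgt x
    src-α x = cong source (δ-ι (reverse G (δ x)))
    tgt-α : ∀ x → tgt (α x) ≡ src x
    tgt-α x = cong target (δ-ι (reverse G (δ x)))

    ends-injective : ∀ {x y} → src x ≡ src y → tgt x ≡ tgt y → x ≡ y
    ends-injective {x} {y} s t = trans (sym (ι-δ x)) (trans (cong ι (dart-ext s t)) (ι-δ y))

    α-involutive : ∀ x → α (α x) ≡ x
    α-involutive x = ends-injective (trans (src-α (α x)) (tgt-α x)) (trans (tgt-α (α x)) (src-α x))

    αₚ : Permutation′ m
    αₚ = permutation α α α-involutive α-involutive

    σ₀ : Permutation′ m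
    σ₀ = ↔-trans (↔-sym E) (↔-trans rotation E)

    same-source : ∀ d d′ → source d ≡ source d′ → related (orbits (σ₀ ⟨$⟩ʳ_)) (ι d) (ι d′)
    same-source d d′ eq = sameOrbit⇒related E next (σ₀ ⟨$⟩ʳ_) (λ _ → refl) (cyclic d d′ eq)

    -- A walk is lifted to darts: rotation at a vertex reaches the dart of the next edge, and
    -- reversal crosses it.
    connected : ∀ {u w} → Star (Adj G) u w → ∀ d d′ → source d ≡ u → source d′ ≡ w →
                related (components (σ₀ ⟨$⟩ʳ_) α) (ι d) (ι d′)
    connected {u} path d d′ = go path d
      where
      C = components (σ₀ ⟨$⟩ʳ_) α
      same : ∀ a b → source a ≡ source b → related C (ι a) (ι b)
      same a b eq = orbits-finest (σ₀ ⟨$⟩ʳ_) (∼-equivalence C) (components-step₁ (σ₀ ⟨$⟩ʳ_) α) (same-source a b eq)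
      go : ∀ {u w} → Star (Adj G) u w → ∀ d → source d ≡ u → source d′ ≡ w → related C (ι d) (ι d′)
      go ε d refl eq = same d d′ (sym eq)
      go {u} (_◅_ {j = v} e path) d refl eq = trans (same d (dart u v e) refl)
        (trans (components-step₂ (σ₀ ⟨$⟩ʳ_) α (ι (dart u v e)))
          (trans (cong (rep C ∘ ι ∘ reverse G) (δ-ι (dart u v e))) (go path (reverse G (dart u v e)) refl eq)))

    genus₀ : Genus₀ α (size (orbits α)) (σ₀ ⟨$⟩ʳ_)
    genus₀ = begin
      size (orbits α) + 2 * size (components (σ₀ ⟨$⟩ʳ_) α)
        ≤⟨ +-mono-≤ (orbits-≤ E (reverse G) α (λ _ → refl) countEdges)
             (ℕₚ.*-monoʳ-≤ 2 (size-≤ E countComponents (components (σ₀ ⟨$⟩ʳ_) α) λ d d′ path → connected path d d′ refl refl)) ⟩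
      #edges + 2 * #components
        ≡⟨ sym euler ⟩
      #vertices + #faces
        ≤⟨ +-mono-≤ (orbits-≥ E next (σ₀ ⟨$⟩ʳ_) (λ _ → refl) countVertices)
             (orbits-≥ E faceStep ((σ₀ ⟨$⟩ʳ_) ∘ α) (λ x → cong (ι ∘ next) (δ-ι (reverse G (δ x)))) countFaces) ⟩
      size (orbits (σ₀ ⟨$⟩ʳ_)) + size (orbits ((σ₀ ⟨$⟩ʳ_) ∘ α)) ∎
      where open ℕₚ.≤-Reasoning

    iff-of : ∀ {Z : Fin m → Set} {g : Fin m → Fin m} → (∀ x → Z x → Z (g x)) → (∀ x → Z (g x) → Z x) →
             ∀ x → (Z x → Z (g x)) × (Z (g x) → Z x)
    iff-of f b x = f x , b x

  module _ (H : Graph n) (sub : H ⊆ᴳ G) (longH : LongCycles H)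
           (min-degree : ∀ u → Positive H u → 2 ≤ degree H u) (edge : ∃₂ (Adj H)) where

    private
      K : Fin m → Set
      K x = Adj H (src x) (tgt x)

      K? : ∀ x → Dec (K x)
      K? x = adj? H (src x) (tgt x)

      K-α : ∀ x → K x → K (α x)
      K-α x k = subst₂ (Adj H) (sym (src-α x)) (sym (tgt-α x)) (Adj-sym H k)

      K-α⁻ : ∀ x → K (α x) → K x
      K-α⁻ x k = subst K (α-involutive x) (K-α (α x) k)

      dartOf : ∀ {u v} → Adj H u v → ∃ λ x → src x ≡ u × tgt x ≡ v × K x
      dartOf {u} {v} a = ι d , cong source (δ-ι d) , cong target (δ-ι d) ,
        subst₂ (Adj H) (sym (cong source (δ-ι d))) (sym (cong target (δ-ι d))) a
        where d = dart u v (sub a)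

      detached : Detached α (size (orbits α)) src K m
      detached = detachAll α αₚ (λ _ → refl) K? (record
        { σ = σ₀ ; genus = genus₀
        ; src-σ = λ x → trans (cong source (δ-ι (next (δ x)))) (next-source (δ x))
        ; around = λ {x} {y} _ _ eq → subst₂ (related (orbits (σ₀ ⟨$⟩ʳ_))) (ι-δ x) (ι-δ y) (same-source (δ x) (δ y) eq)
        ; removed = λ _ () }) m ≤-refl

      open Detached detached

      f = σ ⟨$⟩ʳ_

      f-injective : ∀ {x y} → f x ≡ f y → x ≡ y
      f-injective e = trans (sym (inverseˡ σ)) (trans (cong (σ ⟨$⟩ˡ_) e) (inverseˡ σ))

      fixed : ∀ x → ¬ K x → f x ≡ x
      fixed x = removed x (toℕ<n x)

      K-σ : ∀ x → K x → K (f x)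
      K-σ x k = decidable-stable (K? (f x)) λ ¬k → ¬k (subst K (sym (f-injective (fixed (f x) ¬k))) k)

      K-σ⁻ : ∀ x → K (f x) → K x
      K-σ⁻ x k = decidable-stable (K? x) λ ¬k → ¬k (subst K (fixed x ¬k) k)

      φₚ : Permutation′ m
      φₚ = αₚ ∘ₚ σ

      φ = φₚ ⟨$⟩ʳ_

      K-φ : ∀ x → K x → K (φ x)
      K-φ x = K-σ (α x) ∘ K-α x

      K-φ⁻ : ∀ x → K (φ x) → K x
      K-φ⁻ x = K-α⁻ x ∘ K-σ⁻ (α x)

      src-φ : ∀ x → src (φ x) ≡ tgt x
      src-φ x = trans (src-σ (α x)) (src-α x)

      -- A face that returns along its edge means that `f` fixes `α x`. But the vertex `tgt x` has a
      -- second kept dart, which `around` puts into the same orbit.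
      no-backtracking : ∀ x → K x → src x ≢ tgt (φ x)
      no-backtracking x k eq =
        let d≥2 = min-degree (tgt x) (neighbourSum-≥ H (tgt x) (λ _ → 1) (Adj-sym H k))
            w , a , w≢ = another H (tgt x) {degree H (tgt x) ∸ 2} (sym (ℕₚ.m+[n∸m]≡n d≥2)) (Adj-sym H k)
            y , src-y , tgt-y , Ky = dartOf a
            stuck : f (α x) ≡ α x
            stuck = ends-injective (trans (src-φ x) (sym (src-α x))) (trans (sym eq) (sym (tgt-α x)))
            alone : related (orbits f) (α x) y → y ≡ α x
            alone r = proj₁ (orbits-finest f (iff-equivalence (_≡ α x))
              (iff-of (λ z e → trans (cong f e) stuck) (λ z e → f-injective (trans e (sym stuck)))) r) refl
        in w≢ (trans (sym tgt-y) (trans (cong tgt (alone (around (K-α x k) Ky (trans (src-α x) (sym src-y))))) (tgt-α x)))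

      facePath : ∀ i x → K x → Path H (src x) (tgt x) (tgt (iterate φ i x)) (suc i)
      facePath zero x k = link k
      facePath (suc i) x k = cons k (no-backtracking x k)
        (subst (λ s → Path H s (tgt (φ x)) (tgt (iterate φ i (φ x))) (suc i)) (src-φ x) (facePath i (φ x) (K-φ x k)))

      src-iterate : ∀ i x → src (iterate φ (suc i) x) ≡ tgt (iterate φ i x)
      src-iterate zero x = src-φ x
      src-iterate (suc i) x = src-iterate i (φ x)

      φ-injective : ∀ {x y} → φ x ≡ φ y → x ≡ y
      φ-injective e = trans (sym (inverseˡ φₚ)) (trans (cong (φₚ ⟨$⟩ˡ_) e) (inverseˡ φₚ))

      iterate-outer : ∀ i x → iterate φ (suc i) x ≡ φ (iterate φ i x)
      iterate-outer zero x = refl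
      iterate-outer (suc i) x = iterate-outer i (φ x)

      -- A repetition is shifted back to the start of the face; there it closes a walk of length at
      -- most 6 without backtracking.
      faces-distinct : ∀ x → K x → ∀ i j → i < j → j < 7 → iterate φ i x ≢ iterate φ j x
      faces-distinct x k zero (suc j) _ j<6 e = path-open H longH (facePath j x k) (ℕₚ.≤-pred j<6)
        (trans (cong src e) (src-iterate j x))
      faces-distinct x k (suc i) (suc j) (s≤s i<j) j<6 e = faces-distinct x k i j i<j (ℕₚ.<⇒≤ j<6)
        (φ-injective (trans (sym (iterate-outer i x)) (trans e (iterate-outer j x))))

      α-moves : ∀ x → x ≢ α x
      α-moves x e = adj-irrefl G (subst (λ v → Adj G (src x) v) (sym (trans (cong src e) (src-α x))) (Dart.edge (δ x)))

      -- For a removed dart `φ x` is `α x`, the same edge reversed.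
      pairs-distinct : ∀ x → ¬ K x → ∀ i j → i < j → j < 2 → iterate φ i x ≢ iterate φ j x
      pairs-distinct x ¬k zero (suc zero) _ _ e = α-moves x (trans e (fixed (α x) (¬k ∘ K-α⁻ x)))
      pairs-distinct x ¬k zero (suc (suc j)) _ (s≤s (s≤s ())) e
      pairs-distinct x ¬k (suc i) (suc (suc j)) _ (s≤s (s≤s ())) e
      pairs-distinct x ¬k (suc i) (suc zero) (s≤s ()) _ e

      V = orbits f
      F = orbits φ
      C = components f α

      ¬K? : ∀ x → Dec (¬ K x)
      ¬K? x = ¬? (K? x)

      -- By `around`, kept representatives have different sources.
      vertices-bound : size V ≤ count (positive? H) + count ¬K?
      vertices-bound = begin
        size V ≡⟨ count-split (representative? V) K? ⟩
        count (λ x → representative? V x ×-dec K? x) + count (λ x → representative? V x ×-dec ¬K? x)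
          ≤⟨ +-mono-≤
               (count-injection (λ x → representative? V x ×-dec K? x) (positive? H) src
                 (λ x (_ , k) → neighbourSum-≥ H (src x) (λ _ → 1) k)
                 λ x y (p , k) (q , k′) eq → representative-unique V p q (around k k′ eq))
               (count-mono (λ x → representative? V x ×-dec ¬K? x) ¬K? λ _ → proj₂) ⟩
        count (positive? H) + count ¬K? ∎
        where open ℕₚ.≤-Reasoning

      darts-bound : count ¬K? + count K? ≤ 2 * size (orbits α)
      darts-bound = begin
        count ¬K? + count K?           ≡⟨ ℕₚ.+-comm (count ¬K?) (count K?) ⟩
        count K? + count ¬K?           ≡⟨ sym (count-split every? K?) ⟩
        count every?                     ≤⟨ short-classes (orbits α) αₚ every? (λ _ _ → tt) (λ x _ → orbit x) ⟩
        2 * count (λ x → representative? (orbits α) x ×-dec every? x)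
          ≤⟨ ℕₚ.*-monoʳ-≤ 2 (count-mono (λ x → representative? (orbits α) x ×-dec every? x) (representative? (orbits α)) λ _ → proj₁) ⟩
        2 * size (orbits α)            ∎
        where
        open ℕₚ.≤-Reasoning
        every? : ∀ (x : Fin m) → Dec ⊤
        every? _ = yes tt
        orbit : ∀ x → rep (orbits α) x ≡ x ⊎ rep (orbits α) x ≡ α x
        orbit x = proj₁ (orbits-finest α (iff-equivalence (λ z → z ≡ x ⊎ z ≡ α x))
          (iff-of pair-α (λ z h → subst (λ z → z ≡ x ⊎ z ≡ α x) (α-involutive z) (pair-α (α z) h)))
          (sym (idem (orbits α) x))) (inj₁ refl)
          where
          pair-α : ∀ z → z ≡ x ⊎ z ≡ α x → α z ≡ x ⊎ α z ≡ α x
          pair-α z (inj₁ e) = inj₂ (cong α e)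
          pair-α z (inj₂ e) = inj₁ (trans (cong α e) (α-involutive x))

      -- Removed darts are fixed by `f`, so a removed edge is a component by itself.
      removed-components : count ¬K? ≤ 2 * count (λ x → representative? C x ×-dec ¬K? x)
      removed-components = short-classes C αₚ ¬K? (λ x ¬k → ¬k ∘ K-α⁻ x) component
        where
        component : ∀ x → ¬ K x → rep C x ≡ x ⊎ rep C x ≡ α x
        component x ¬k = proj₁ (components-finest f α (iff-equivalence Z)
          (iff-of (λ z h → subst Z (sym (fixed z (outside z h))) h)
            (λ z h → subst Z (f-injective (fixed (f z) (outside (f z) h))) h))
          (iff-of pair-α (λ z h → subst Z (α-involutive z) (pair-α (α z) h)))
          (sym (idem C x))) (inj₁ refl)
          where
          Z : Fin m → Set
          Z z = z ≡ x ⊎ z ≡ α x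
          outside : ∀ z → Z z → ¬ K z
          outside z (inj₁ refl) = ¬k
          outside z (inj₂ refl) = ¬k ∘ K-α⁻ x
          pair-α : ∀ z → Z z → Z (α z)
          pair-α z (inj₁ e) = inj₂ (cong α e)
          pair-α z (inj₂ e) = inj₁ (trans (cong α e) (α-involutive x))

      kept-component : 1 ≤ count (λ x → representative? C x ×-dec K? x)
      kept-component =
        let x , _ , _ , k = dartOf (proj₂ (proj₂ edge))
        in count-positive (λ x → representative? C x ×-dec K? x) {rep C x} (idem C x ,
             proj₁ (components-finest f α (iff-equivalence K) (iff-of K-σ K-σ⁻) (iff-of K-α K-α⁻) (sym (idem C x))) k)

      degrees : sum (degree H) ≤ count K?
      degrees = begin
        sum (λ u → sum (λ v → when (adj? H u v) 1)) ≤⟨ sum-mono (λ u → sum-mono λ v → when-≤ (adj? H u v) (has-dart u v)) ⟩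
        sum (λ u → sum (λ v → sum (λ x → when (tgt x ≟ v) (when (src x ≟ u) (when (K? x) 1)))))
          ≡⟨ sum-cong-≗ (λ u → fibre-sum tgt (λ x → when (src x ≟ u) (when (K? x) 1))) ⟩
        sum (λ u → sum (λ x → when (src x ≟ u) (when (K? x) 1))) ≡⟨ fibre-sum src (λ x → when (K? x) 1) ⟩
        count K? ∎
        where
        open ℕₚ.≤-Reasoning
        has-dart : ∀ u v → Adj H u v → 1 ≤ sum (λ x → when (tgt x ≟ v) (when (src x ≟ u) (when (K? x) 1)))
        has-dart u v a =
          let x , s , t , k = dartOf a
          in ≤-trans (≤-reflexive (sym (trans (when-yes (tgt x ≟ v) t) (trans (when-yes (src x ≟ u) s) (when-yes (K? x) k)))))
               (sum-≥ (λ x → when (tgt x ≟ v) (when (src x ≟ u) (when (K? x) 1))) x)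

    euler-bound : 5 * sum (degree H) + 28 ≤ 14 * count (positive? H)
    euler-bound = euler-arithmetic {size (orbits α)} {size C} {size V} {size F} {count (positive? H)}
      {count ¬K?} {count K?} {kept F} {gone F} {kept C} {gone C} {sum (degree H)}
      genus vertices-bound
      (≤-reflexive (count-split (representative? F) K?))
      (long-orbits φₚ K? 7 K-φ⁻ faces-distinct)
      (long-orbits φₚ ¬K? 2 (λ x ¬k k → ¬k (K-φ x k)) pairs-distinct)
      darts-bound
      (≤-reflexive (trans (ℕₚ.+-comm (gone C) (kept C)) (sym (count-split (representative? C) K?))))
      removed-components kept-component degrees
      where
      kept gone : Partition m → ℕ
      kept P = count (λ x → representative? P x ×-dec K? x)
      gone P = count (λ x → representative? P x ×-dec ¬K? x)

theorem4p12 : ∀ {n : ℕ} (G : Graph n) → Planar G → GirthAtLeast 7 G →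
    (π : EdgeLabelling G) →
    Σ (Fin n → Vec 𝔽₂ 3) λ vec → IsInversion G π 3 vec × IsStrict vec
theorem4p12 {n} G planar girth π = vectorOf ∘ proj₁ colouring ,
  (λ d → trans (sym (labels-label (adj? G (source d) (target d)) (Dart.edge d)))
           (sym (proj₂ colouring (source d) (target d) (Dart.edge d)))) ,
  (λ v → vectorOf≢0 (proj₁ colouring v))
  where
  open EdgeLabelling π

  long : LongCycles G
  long = from-girth girth
    where
    from-girth : GirthAtLeast 7 G → LongCycles G
    from-girth (_ , shortest _ minimal , [ 7≤ ]≤) C = ≤-trans 7≤ (minimal C)
    from-girth (_ , forest acyclic , _) C = contradiction C acyclic

  -- The recolouring works with labels on all pairs of vertices; on non-adjacent pairs the value is
  -- an arbitrary default.
  labelBy : ∀ {u v} → Dec (Adj G u v) → 𝔽₂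
  labelBy {u} {v} (yes e) = label (dart u v e)
  labelBy (no _) = 0ℙ

  labels : Fin n → Fin n → 𝔽₂
  labels u v = labelBy (adj? G u v)

  labels-label : ∀ {u v} (d : Dec (Adj G u v)) (e : Adj G u v) → labelBy d ≡ label (dart u v e)
  labels-label {u} {v} (yes e′) e = cong (label ∘ dart u v) (T-irrelevant e′ e)
  labels-label (no ¬e) e = contradiction e ¬e

  labels-sym : ∀ u v → labels u v ≡ labels v u
  labels-sym u v = by-adjacency (adj? G u v) (adj? G v u)
    where
    by-adjacency : (d : Dec (Adj G u v)) (d′ : Dec (Adj G v u)) → labelBy d ≡ labelBy d′
    by-adjacency (yes e) d′ = sym (trans (labels-label d′ (Adj-sym G e)) (label-reverse (dart u v e)))
    by-adjacency (no ¬e) (yes e) = contradiction (Adj-sym G e) ¬e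
    by-adjacency (no _) (no _) = refl

  colouring : ∃ (Proper G labels)
  colouring = decidable-stable (colourable? G labels) (¬¬colourable G long
    (λ H sub min-degree edge → euler-bound G planar H sub (long ∘ subgraph-cycle sub) min-degree edge)
    labels labels-sym G id)
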